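{- Let $r\ge 0$ and $k$ be integers with $0\le k\le r$. Consider pairs of families $\mathcal{A}\subset\mathbb{N}^{(r)}$, $\mathcal{B}\subset\mathbb{N}^{(r-1)}$ such that every $A\in\mathcal{A}$ contains at least $k$ distinct members of $\mathcal{B}$ as subsets, and write $a=|\mathcal{A}|$, $b=|\mathcal{B}|$. Then: (i) If $k=0$, the minimum possible value of $b$ is $0$, for every value of $a$. (ii) If $k=1$, the minimum possible value of $b$ is $1$ if $a\ge 1$, and $0$ if $a=0$. (iii) If $k=2$, then $f(r,2,b)=\binom{b}{2}$ for every integer $b\ge 0$. (iv) If $k=3$, then for all integers $c_2>c_1\ge 0$ with $c_2\ge 29$, \[f\left(r,3,\binom{c_2}{2}+\binom{c_1}{1}\right)=\binom{c_2}{3}+\binom{c_1}{2}.\]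
   Context: $\mathbb{N}^{(s)}$ denotes the family of all $s$-element subsets of $\mathbb{N}$. For integers $0\le k\le r$ and $b\ge 0$, $f(r,k,b)$ denotes the maximum of $|\mathcal{A}|$ over all pairs of families $\mathcal{A}\subset\mathbb{N}^{(r)}$, $\mathcal{B}\subset\mathbb{N}^{(r-1)}$ with $|\mathcal{B}|=b$ such that for every $A\in\mathcal{A}$ there exist $k$ distinct sets $B_1,\dots,B_k\in\mathcal{B}$ with $B_i\subset A$ for all $i$. Binomial coefficients $\binom{c}{i}$ with $c<i$ are $0$. -}

module Defs where

open import Data.List.Base using (List; length)
open import Data.List.Membership.Propositional using () renaming (_∈_ to _∈ₗ_)
open import Data.List.Relation.Binary.Subset.Propositional using () renaming (_⊆_ to _⊆ₗ_)
open import Data.List.Relation.Unary.All using (All)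
open import Data.List.Relation.Unary.AllPairs using (AllPairs)
open import Data.List.Relation.Unary.Unique.Propositional using (Unique)
open import Data.Nat.Base using (ℕ; suc; _≤_; _<_)
open import Data.Product.Base using (∃-syntax; _×_)
open import Function.Bundles using (_⇔_)
open import Level using (0ℓ)
open import Relation.Binary.PropositionalEquality.Core using (_≡_)
open import Relation.Nullary.Construct.Add.Supremum using (_⁺; ⊤⁺; [_])
open import Relation.Unary using (Pred; _∈_)

-- A finite subset of ℕ is the strictly increasing list of its elements, so
-- that propositional equality is equality of sets.
record FinSet : Set where
  constructor mkFinSet
  field
    elements    : List ℕ
    .increasing : AllPairs _<_ elements

open FinSet public using (elements)

∣_∣ : FinSet → ℕ
∣ S ∣ = length (elements S)

infix 4 _⊆_

_⊆_ : FinSet → FinSet → Set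
S ⊆ T = elements S ⊆ₗ elements T

-- Families may be infinite and need not be decidable.
Family : Set₁
Family = Pred FinSet 0ℓ

AtLeast : ℕ → Family → Set
AtLeast n 𝓕 = ∃[ Ss ] Unique Ss × All (_∈ 𝓕) Ss × length Ss ≡ n

AtMost : ℕ → Family → Set
AtMost n 𝓕 = ∀ Ss → Unique Ss → All (_∈ 𝓕) Ss → length Ss ≤ n

Exactly : ℕ → Family → Set
Exactly n 𝓕 = ∃[ Ss ] Unique Ss × (∀ S → S ∈ₗ Ss ⇔ S ∈ 𝓕) × length Ss ≡ n

-- Every family is countable, so its cardinality lies in ℕ ⁺, with ⊤⁺ for
-- infinite families.
HasCard : Family → ℕ ⁺ → Set
HasCard 𝓕 [ n ] = Exactly n 𝓕
HasCard 𝓕 ⊤⁺    = ∀ n → AtLeast n 𝓕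

-- 𝓐 ⊂ ℕ⁽ʳ⁾, 𝓑 ⊂ ℕ⁽ʳ⁻¹⁾ and every member of 𝓐 contains at least k members
-- of 𝓑.  Writing |B| = r - 1 as |B| + 1 = r makes ℕ⁽⁻¹⁾ empty.
record Admissible (r k : ℕ) (𝓐 𝓑 : Family) : Set where
  field
    𝓐-size   : ∀ A → A ∈ 𝓐 → ∣ A ∣ ≡ r
    𝓑-size   : ∀ B → B ∈ 𝓑 → suc ∣ B ∣ ≡ r
    contains : ∀ A → A ∈ 𝓐 → AtLeast k (λ B → B ∈ 𝓑 × B ⊆ A)

Attainable : (r k : ℕ) → ℕ ⁺ → Set₁
Attainable r k a = ∃[ 𝓐 ] ∃[ 𝓑 ] Admissible r k 𝓐 𝓑 × HasCard 𝓐 a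

-- m is the minimum of |𝓑| over admissible pairs with |𝓐| = a.
MinimumB : (r k : ℕ) → ℕ ⁺ → ℕ → Set₁
MinimumB r k a m =
  (∃[ 𝓐 ] ∃[ 𝓑 ] Admissible r k 𝓐 𝓑 × HasCard 𝓐 a × HasCard 𝓑 [ m ]) ×
  (∀ 𝓐 𝓑 → Admissible r k 𝓐 𝓑 → HasCard 𝓐 a → AtLeast m 𝓑)

-- f(r,k,b) = m, that is, m is the maximum of |𝓐| over admissible pairs with
-- |𝓑| = b.  It is a relation because the maximum need not exist.
F : (r k b m : ℕ) → Set₁
F r k b m =
  (∃[ 𝓐 ] ∃[ 𝓑 ] Admissible r k 𝓐 𝓑 × HasCard 𝓑 [ b ] × HasCard 𝓐 [ m ]) ×
  (∀ 𝓐 𝓑 → Admissible r k 𝓐 𝓑 → HasCard 𝓑 [ b ] → AtMost m 𝓐)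

{-# OPTIONS --safe #-}
-- Parts (iii) and (iv) are instances of extremal bounds on |𝓐|.  For k = 2 a
-- member of 𝓐 is the union of any two members of 𝓑 inside it.  For k = 3 let
-- kk (C(c,2) + e) = C(c,3) + C(e,2) for e ≤ c; then |𝓐| ≤ kk |𝓑| by induction
-- on |𝓑|.  Choose x and split 𝓑 into L = {B ∋ x} and Z = {B ∌ x}, b = |Z|.  The
-- members of 𝓐 avoiding x number at most kk b by induction.  Each member of 𝓐
-- containing x contains at most one member of Z, and no member of Z lies in
-- two of them; so if s₂ and s₃ count the sets with at least 2 and at least 3
-- members of L inside, then the number y of members of 𝓐 containing x satisfies
-- y ≤ s₂, y ≤ b + s₃ and s₃ ≤ kk |L|.
--
-- The decisive bound is y ≤ max(b, C(c,2)) + C(j,2) whenever |L| = c + j.  It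
-- rests on estimates of s₂ + s₃.  For M₁, M₂ ∈ L inside a common T, the star of
-- M₁ ∩ M₂ consists of the M ∈ L containing M₁ ∩ M₂.  A member of L outside the
-- star lies in at most one T containing M₁ ∩ M₂, so a largest star can be
-- peeled off cheaply; and if all stars have at most m members, then removing M₁
-- and M₂ from L lowers s₂ + s₃ by at most |L| + m - 3.
--
-- A member of 𝓑 inside three members of 𝓐 yields an x with |Z| ≥ 5; if there is
-- none, then 3 |𝓐| ≤ 2 |𝓑|.
module Submission where

open import Defs
open import Data.Bool.Base using (if_then_else_; true; false) renaming (T to True)
open import Data.Empty using (⊥; ⊥-elim)
open import Data.List.Base using (List; []; _∷_; _++_; length; filter; map)
open import Data.List.Membership.Propositional using (find; lose) renaming (_∈_ to _∈ₗ_; _∉_ to _∉ₗ_)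
open import Data.List.Membership.Propositional.Properties
  using (∈-∃++; ∈-++⁺ˡ; ∈-++⁺ʳ; ∈-++⁻; ∈-filter⁺; ∈-filter⁻; ∈-map⁺; ∈-map⁻)
open import Data.List.Properties using (length-map; length-++; map-id; ∷-injectiveʳ; ≡-dec)
open import Data.List.Relation.Binary.Permutation.Propositional
  using (_↭_; refl; prep; swap; ↭-sym; ↭-trans; ↭⇒↭ₛ) renaming (trans to trans↭)
open import Data.List.Relation.Binary.Permutation.Propositional.Properties using (shift; ↭-length; ∈-resp-↭)
open import Data.List.Relation.Unary.All as All using (All; []; _∷_)
open import Data.List.Relation.Unary.All.Properties using () renaming (map⁺ to All-map⁺)
open import Data.List.Relation.Unary.AllPairs as AllPairs using (AllPairs; []; _∷_; allPairs?)
open import Data.List.Relation.Unary.Any using (here; there; any?)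
open import Data.List.Relation.Unary.Unique.Propositional using (Unique)
open import Data.List.Relation.Unary.Unique.Propositional.Properties
  using (Unique[x∷xs]⇒x∉xs) renaming (filter⁺ to unique-filter; map⁺ to unique-map; ++⁺ to unique-++)
open import Data.Nat.Base
  using (ℕ; zero; suc; _+_; _*_; _∸_; _⊔_; _≤_; _<_; z≤n; s≤s; s≤s⁻¹; _<ᵇ_)
open import Data.Nat.Combinatorics using (_C_; nCk+nC[k+1]≡[n+1]C[k+1]; nC1≡n)
open import Data.Nat.Properties
open import Data.Nat.Tactic.RingSolver using (solve-∀)
open import Data.Product.Base using (∃; ∃₂; ∃-syntax; _×_; _,_; proj₁; proj₂)
open import Data.Sum.Base using (_⊎_; inj₁; inj₂)
open import Data.Unit.Base using (tt)
open import Function.Base using (_∘_)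
open import Function.Bundles using (_⇔_; mk⇔; Equivalence)
open import Relation.Binary.Definitions using (DecidableEquality)
open import Relation.Binary.PropositionalEquality
  using (_≡_; _≢_; refl; sym; trans; cong; cong₂; subst; setoid; module ≡-Reasoning)
open import Relation.Binary.PropositionalEquality using () renaming (trans to _∙_)
open import Relation.Nullary using (Dec; yes; no; ¬_; contradiction; ¬?)
open import Relation.Nullary.Decidable using (map′; recompute; toWitness; _→-dec_; _×-dec_)
open import Relation.Nullary.Construct.Add.Supremum using (_⁺; ⊤⁺; [_])
open import Relation.Unary using (Decidable)
open import Relation.Binary.Construct.Add.Supremum.NonStrict _≤_ using (_≤⁺_; [_])
open import Data.List.Membership.DecPropositional _≟_ using (_∈?_)
open import Data.List.Relation.Binary.Subset.DecPropositional _≟_ using () renaming (_⊆_ to _⊆ₗ_; _⊆?_ to _⊆ₗ?_)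
open import Data.List.Relation.Binary.Permutation.Setoid.Properties (setoid FinSet) using (Unique-resp-↭)

private variable
  P Q X Y : Set
  A A′ B B′ T : FinSet

-- Binomial coefficients and the function kk

-- The binomial coefficients C(n,2) and C(n,3), defined by Pascal's rule so that `suc n` unfolds in
-- computations.
tri tet : ℕ → ℕ
tri zero    = 0
tri (suc n) = n + tri n
tet zero    = 0
tet (suc n) = tri n + tet n

tri≡C : ∀ n → tri n ≡ n C 2
tri≡C zero    = refl
tri≡C (suc n) = trans (cong₂ _+_ (sym (nC1≡n n)) (tri≡C n)) (nCk+nC[k+1]≡[n+1]C[k+1] n 1)

tet≡C : ∀ n → tet n ≡ n C 3
tet≡C zero    = refl
tet≡C (suc n) = trans (cong₂ _+_ (tri≡C n) (tet≡C n)) (nCk+nC[k+1]≡[n+1]C[k+1] n 2)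

tri-+ : ∀ a b → tri (a + b) ≡ tri a + tri b + a * b
tri-+ zero    b = sym (+-identityʳ _)
tri-+ (suc a) b rewrite tri-+ a b = lemma a b (tri a) (tri b)
  where
  lemma : ∀ a b x y → a + b + (x + y + a * b) ≡ a + x + y + (b + a * b)
  lemma = solve-∀

tri-mono : ∀ {a b} → a ≤ b → tri a ≤ tri b
tri-mono z≤n       = z≤n
tri-mono (s≤s a≤b) = +-mono-≤ a≤b (tri-mono a≤b)

double-tri : ∀ n → tri n + tri n + n ≡ n * n
double-tri zero    = refl
double-tri (suc n) = trans (lemma n (tri n)) (cong (λ z → z + n + n + 1) (double-tri n) ∙ lemma₂ n)
  where
  lemma : ∀ n t → n + t + (n + t) + suc n ≡ t + t + n + n + n + 1
  lemma = solve-∀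
  lemma₂ : ∀ n → n * n + n + n + 1 ≡ suc n * suc n
  lemma₂ = solve-∀

-- Convexity of `tri`: with a = w + α and b = w + β one gets c = w + α + β, and the two sides differ
-- by exactly α β.
tri-majorize : ∀ {a b c w} → a ≤ c → b ≤ c → a + b ≡ c + w → tri a + tri b ≤ tri c + tri w
tri-majorize {a} {b} {c} {w} a≤c b≤c eq
  with β , refl ← m≤n⇒∃[o]m+o≡n a≤c
  with refl ← +-cancelˡ-≡ a b (β + w) (trans eq (+-assoc a β w))
  with α , refl ← m≤n⇒∃[o]m+o≡n (+-cancelˡ-≤ β w a (≤-trans b≤c (≤-reflexive (+-comm a β))))
  = begin
    tri (w + α) + tri (β + w)
      ≡⟨ cong₂ _+_ (tri-+ w α) (tri-+ β w) ⟩
    tri w + tri α + w * α + (tri β + tri w + β * w)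
      ≤⟨ m≤m+n _ (α * β) ⟩
    tri w + tri α + w * α + (tri β + tri w + β * w) + α * β
      ≡⟨ lemma w α β (tri w) (tri α) (tri β) ⟩
    tri w + tri α + w * α + tri β + (w + α) * β + tri w
      ≡⟨ cong (λ z → z + tri β + (w + α) * β + tri w) (tri-+ w α) ⟨
    tri (w + α) + tri β + (w + α) * β + tri w
      ≡⟨ cong (_+ tri w) (tri-+ (w + α) β) ⟨
    tri (w + α + β) + tri w ∎
  where
  open ≤-Reasoning
  lemma : ∀ w α β x y z →
    x + y + w * α + (z + x + β * w) + α * β ≡ x + y + w * α + z + (w + α) * β + x
  lemma = solve-∀

-- Writing n = tri c + e with e < c, the increment kk (n + 1) - kk n is e.  The
-- pair pos n = (c , e) and kk n are computed in a single recursion because the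
-- small cases of superadditivity below are settled by evaluation.
next : ℕ × ℕ → ℕ × ℕ
next (c , e) = if suc e <ᵇ c then (c , suc e) else (suc c , 0)

step : (ℕ × ℕ) × ℕ → (ℕ × ℕ) × ℕ
step s = next (proj₁ s) , proj₂ s + proj₂ (proj₁ s)

state : ℕ → (ℕ × ℕ) × ℕ
state zero    = (1 , 0) , 0
state (suc n) = step (state n)

pos : ℕ → ℕ × ℕ
pos n = proj₁ (state n)

kk : ℕ → ℕ
kk n = proj₂ (state n)

next-inside : ∀ {c e} → suc e < c → next (c , e) ≡ (c , suc e)
next-inside {c} {e} lt with suc e <ᵇ c in eq
... | true  = refl
... | false = ⊥-elim (subst True eq (<⇒<ᵇ lt))

next-end : ∀ e → next (suc e , e) ≡ (suc (suc e) , 0)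
next-end e with suc e <ᵇ suc e in eq
... | false = refl
... | true  = ⊥-elim (<-irrefl refl (<ᵇ⇒< e e (subst True (sym eq) tt)))

pos-row : ∀ c e → e < c → pos (tri c + e) ≡ (c , e)
pos-row (suc zero)    zero    _  = refl
pos-row (suc (suc c)) zero    _  =
  trans (cong pos (trans (+-identityʳ _) (cong suc (+-comm c (tri (suc c))))))
  (trans (cong next (pos-row (suc c) c ≤-refl)) (next-end c))
pos-row c             (suc e) lt =
  trans (cong pos (+-suc (tri c) e))
  (trans (cong next (pos-row c e (<⇒≤ lt))) (next-inside lt))

row : ∀ n → ∃₂ λ c e → e < c × n ≡ tri c + e
row zero = 1 , 0 , s≤s z≤n , refl
row (suc n) with row n
... | c , e , e<c , refl with m≤n⇒m<n∨m≡n e<c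
...   | inj₁ lt   = c , suc e , lt , sym (+-suc (tri c) e)
...   | inj₂ refl = suc c , 0 , s≤s z≤n ,
  trans (cong suc (+-comm (tri c) e)) (sym (+-identityʳ _))

kk-row : ∀ c e → e ≤ c → kk (tri c + e) ≡ tet c + tri e
kk-row zero    zero    _  = refl
kk-row (suc c) zero    _  =
  trans (cong kk (trans (+-identityʳ _) (+-comm c (tri c))))
  (trans (kk-row c c ≤-refl) (trans (+-comm (tet c) (tri c)) (sym (+-identityʳ _))))
kk-row c       (suc e) lt =
  trans (cong kk (+-suc (tri c) e))
  (trans (cong₂ _+_ (kk-row c e (<⇒≤ lt)) (cong proj₂ (pos-row c e lt)))
  (trans (+-assoc (tet c) (tri e) e) (cong (tet c +_) (+-comm (tri e) e))))

kk-tri : ∀ c → kk (tri c) ≡ tet c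
kk-tri c = trans (cong kk (sym (+-identityʳ (tri c)))) (trans (kk-row c 0 z≤n) (+-identityʳ _))

kk-mono-+ : ∀ n k → kk n ≤ kk (n + k)
kk-mono-+ n zero    = ≤-reflexive (cong kk (sym (+-identityʳ n)))
kk-mono-+ n (suc k) rewrite +-suc n k = ≤-trans (kk-mono-+ n k) (m≤m+n _ _)

kk-mono : ∀ {m n} → m ≤ n → kk m ≤ kk n
kk-mono {m} m≤n with k , refl ← m≤n⇒∃[o]m+o≡n m≤n = kk-mono-+ m k

-- If t more elements still fit into the row, superadditivity of `tri` is enough. If they overflow
-- by w, then e + t = c + w, and `tri-majorize` compares a full row and w with the two pieces e and
-- t.
kk-append-row : ∀ c e t → e ≤ c → t ≤ c → kk (tri c + e) + tri t ≤ kk (tri c + e + t)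
kk-append-row c e t e≤c t≤c with ≤-total (e + t) c
... | inj₁ e+t≤c = begin
  kk (tri c + e) + tri t      ≡⟨ cong (_+ tri t) (kk-row c e e≤c) ⟩
  tet c + tri e + tri t       ≡⟨ +-assoc (tet c) _ _ ⟩
  tet c + (tri e + tri t)     ≤⟨ +-monoʳ-≤ (tet c) (m≤m+n _ (e * t)) ⟩
  tet c + (tri e + tri t + e * t) ≡⟨ cong (tet c +_) (tri-+ e t) ⟨
  tet c + tri (e + t)         ≡⟨ kk-row c (e + t) e+t≤c ⟨
  kk (tri c + (e + t))        ≡⟨ cong kk (+-assoc (tri c) e t) ⟨
  kk (tri c + e + t)          ∎
  where open ≤-Reasoning
... | inj₂ c≤e+t with w , c+w≡e+t ← m≤n⇒∃[o]m+o≡n c≤e+t = begin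
  kk (tri c + e) + tri t      ≡⟨ cong (_+ tri t) (kk-row c e e≤c) ⟩
  tet c + tri e + tri t       ≡⟨ +-assoc (tet c) _ _ ⟩
  tet c + (tri e + tri t)     ≤⟨ +-monoʳ-≤ (tet c) (tri-majorize e≤c t≤c (sym c+w≡e+t)) ⟩
  tet c + (tri c + tri w)     ≡⟨ lemma (tet c) (tri c) (tri w) ⟩
  tet (suc c) + tri w         ≡⟨ kk-row (suc c) w (m≤n⇒m≤1+n w≤c) ⟨
  kk (c + tri c + w)          ≡⟨ cong kk (lemma₂ c (tri c) w) ⟩
  kk (tri c + (c + w))        ≡⟨ cong (λ z → kk (tri c + z)) c+w≡e+t ⟩
  kk (tri c + (e + t))        ≡⟨ cong kk (+-assoc (tri c) e t) ⟨
  kk (tri c + e + t)          ∎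
  where
  open ≤-Reasoning
  w≤c : w ≤ c
  w≤c = +-cancelˡ-≤ c w c (≤-trans (≤-reflexive c+w≡e+t) (+-mono-≤ e≤c t≤c))
  lemma : ∀ x y z → x + (y + z) ≡ y + x + z
  lemma = solve-∀
  lemma₂ : ∀ x y z → x + y + z ≡ y + (x + z)
  lemma₂ = solve-∀

tri-cancel : ∀ {t c e} → e < c → tri t ≤ tri c + e → t ≤ c
tri-cancel {t} {c} {e} e<c le with t ≤? c
... | yes p = p
... | no ¬p = ⊥-elim (<⇒≱ (begin-strict
  tri c + e   <⟨ +-monoʳ-< (tri c) e<c ⟩
  tri c + c   ≡⟨ +-comm (tri c) c ⟩
  tri (suc c) ≤⟨ tri-mono (≰⇒> ¬p) ⟩
  tri t       ∎) le)
  where open ≤-Reasoning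

kk-append : ∀ y t → tri t ≤ y → kk y + tri t ≤ kk (y + t)
kk-append y t le with row y
... | c , e , e<c , refl = kk-append-row c e t (<⇒≤ e<c) (tri-cancel e<c le)

-- `suc c` further elements lead from place e of row c to place `suc e` of row `suc c`, and by
-- Pascal's rule the gain is the number itself. This pays for the summand b in `Superadditive`.
kk-shift : ∀ c e → e < c → kk (tri c + e + suc c) ≡ kk (tri c + e) + (tri c + e)
kk-shift c e e<c = begin
  kk (tri c + e + suc c)            ≡⟨ cong kk (lemma (tri c) e c) ⟩
  kk (tri (suc c) + suc e)          ≡⟨ kk-row (suc c) (suc e) (m≤n⇒m≤1+n e<c) ⟩
  tri c + tet c + (e + tri e)       ≡⟨ lemma₂ (tri c) (tet c) e (tri e) ⟩
  tet c + tri e + (tri c + e)       ≡⟨ cong (_+ (tri c + e)) (kk-row c e (<⇒≤ e<c)) ⟨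
  kk (tri c + e) + (tri c + e)      ∎
  where
  open ≡-Reasoning
  lemma : ∀ x e c → x + e + suc c ≡ c + x + suc e
  lemma = solve-∀
  lemma₂ : ∀ x y e z → x + y + (e + z) ≡ y + z + (x + e)
  lemma₂ = solve-∀

-- Superadditivity inequalities for `kk`

Superadditive : ℕ → ℕ → Set
Superadditive b l = kk b + b + kk l ≤ kk (b + l)

-- At the start of a row, appending t elements raises kk by tri t, the least gain
-- possible from there on (kk-append).
superadditive-row : ∀ b p → Superadditive b (tri p) → ∀ {q t} → p ≤ q → t ≤ q →
  Superadditive b (tri q + t)
superadditive-row b p base {q} {t} p≤q t≤q with q′ , refl ← m≤n⇒∃[o]m+o≡n p≤q =
  append (rows q′) t≤q
  where
  open ≤-Reasoning
  append : ∀ {q t} → Superadditive b (tri q) → t ≤ q → Superadditive b (tri q + t)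
  append {q} {t} h t≤q = begin
    kk b + b + kk (tri q + t)      ≡⟨ cong (kk b + b +_) (kk-row q t t≤q) ⟩
    kk b + b + (tet q + tri t)     ≡⟨ +-assoc (kk b + b) (tet q) (tri t) ⟨
    kk b + b + tet q + tri t       ≡⟨ cong (λ z → kk b + b + z + tri t) (kk-tri q) ⟨
    kk b + b + kk (tri q) + tri t  ≤⟨ +-monoˡ-≤ (tri t) h ⟩
    kk (b + tri q) + tri t         ≤⟨ kk-append (b + tri q) t (≤-trans (tri-mono t≤q) (m≤n+m _ b)) ⟩
    kk (b + tri q + t)             ≡⟨ cong kk (+-assoc b (tri q) t) ⟩
    kk (b + (tri q + t))           ∎
  rows : ∀ k → Superadditive b (tri (p + k))
  rows zero    = subst (Superadditive b ∘ tri) (sym (+-identityʳ p)) base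
  rows (suc k) = subst (Superadditive b) eq (append (rows k) (≤-refl {p + k}))
    where
    eq : tri (p + k) + (p + k) ≡ tri (p + suc k)
    eq = trans (+-comm (tri (p + k)) (p + k)) (cong tri (sym (+-suc p k)))

-- The first `suc c` appended elements gain b by `kk-shift`; the next c gain at least `tri c` by
-- `kk-append`, which covers `kk l`.
superadditive-near : ∀ c e l → e < c → 2 * c < l → kk l ≤ tri c → Superadditive (tri c + e) l
superadditive-near c e l e<c 2c<l kkl≤ = begin
  kk b + b + kk l        ≡⟨ cong (_+ kk l) (kk-shift c e e<c) ⟨
  kk (b + suc c) + kk l  ≤⟨ +-monoʳ-≤ (kk (b + suc c)) kkl≤ ⟩
  kk (b + suc c) + tri c ≤⟨ kk-append (b + suc c) c (≤-trans (m≤m+n (tri c) e) (m≤m+n b (suc c))) ⟩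
  kk (b + suc c + c)     ≤⟨ kk-mono (≤-trans (≤-reflexive (lemma b c)) (+-monoʳ-≤ b 2c<l)) ⟩
  kk (b + l)             ∎
  where
  open ≤-Reasoning
  b = tri c + e
  lemma : ∀ b c → b + suc c + c ≡ b + suc (2 * c)
  lemma = solve-∀

-- When 2c = tri q this is 8 times `tet (suc q) ≤ tri c`, because 8 tri c = (2c)² - 2(2c). It fails
-- at q = 7 (490 against 441), so the induction starts at 8.
tet-bound : ∀ k → let q = 8 + k in 8 * tet (suc q) + 2 * tri q ≤ tri q * tri q
tet-bound zero    = toWitness {a? = 8 * tet 9 + 2 * tri 8 ≤? tri 8 * tri 8} tt
tet-bound (suc k) = begin
  8 * (q + τ + tet (suc q)) + 2 * (q + τ)
    ≡⟨ lemma q τ (tet (suc q)) ⟩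
  8 * tet (suc q) + 2 * τ + (8 * q + 8 * τ + 2 * q)
    ≤⟨ +-mono-≤ (tet-bound k) (+-monoˡ-≤ (2 * q) (+-monoˡ-≤ (8 * τ) (*-monoʳ-≤ 8 q≤τ))) ⟩
  τ * τ + (8 * τ + 8 * τ + 2 * q)
    ≤⟨ +-monoʳ-≤ (τ * τ) (+-mono-≤ (≤-trans (≤-reflexive (lemma₂ τ)) (*-monoˡ-≤ τ (*-monoʳ-≤ 2 8≤q)))
         (*-monoˡ-≤ q (≤-trans (s≤s (s≤s z≤n)) 8≤q))) ⟩
  τ * τ + (2 * q * τ + q * q)
    ≡⟨ lemma₃ q τ ⟩
  (q + τ) * (q + τ) ∎
  where
  open ≤-Reasoning
  q = 8 + k
  τ = tri q
  8≤q : 8 ≤ q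
  8≤q = m≤m+n 8 k
  q≤τ : q ≤ τ
  q≤τ = ≤-trans (≤-reflexive (+-comm 1 (7 + k))) (+-monoʳ-≤ (7 + k) (s≤s z≤n))
  lemma : ∀ q τ x → 8 * (q + τ + x) + 2 * (q + τ) ≡ 8 * x + 2 * τ + (8 * q + 8 * τ + 2 * q)
  lemma = solve-∀
  lemma₂ : ∀ τ → 8 * τ + 8 * τ ≡ 2 * 8 * τ
  lemma₂ = solve-∀
  lemma₃ : ∀ q τ → τ * τ + (2 * q * τ + q * q) ≡ (q + τ) * (q + τ)
  lemma₃ = solve-∀

tet≤tri : ∀ q c → 8 ≤ q → tri q ≤ 2 * c → tet (suc q) ≤ tri c
tet≤tri q c 8≤q le with f , eq ← m≤n⇒∃[o]m+o≡n le =
  *-cancelˡ-≤ 8 (+-cancelʳ-≤ (2 * (2 * c)) _ _ (begin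
    8 * tet (suc q) + 2 * (2 * c)     ≡⟨ cong (λ z → 8 * tet (suc q) + 2 * z) eq ⟨
    8 * tet (suc q) + 2 * (τ + f)     ≡⟨ lemma (tet (suc q)) τ f ⟩
    8 * tet (suc q) + 2 * τ + 2 * f   ≤⟨ +-mono-≤ bound (*-monoˡ-≤ f (*-monoʳ-≤ 2 1≤τ)) ⟩
    τ * τ + 2 * τ * f                 ≤⟨ m≤m+n _ (f * f) ⟩
    τ * τ + 2 * τ * f + f * f         ≡⟨ lemma₂ τ f ⟩
    (τ + f) * (τ + f)                 ≡⟨ cong₂ _*_ eq eq ⟩
    2 * c * (2 * c)                   ≡⟨ lemma₃ c ⟩
    4 * (c * c)                       ≡⟨ cong (4 *_) (double-tri c) ⟨
    4 * (tri c + tri c + c)           ≡⟨ lemma₄ (tri c) c ⟩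
    8 * tri c + 2 * (2 * c)           ∎))
  where
  open ≤-Reasoning
  τ = tri q
  1≤τ : 1 ≤ τ
  1≤τ = ≤-trans (s≤s z≤n) (tri-mono 8≤q)
  bound : 8 * tet (suc q) + 2 * τ ≤ τ * τ
  bound with k , refl ← m≤n⇒∃[o]m+o≡n 8≤q = tet-bound k
  lemma : ∀ x τ f → 8 * x + 2 * (τ + f) ≡ 8 * x + 2 * τ + 2 * f
  lemma = solve-∀
  lemma₂ : ∀ τ f → τ * τ + 2 * τ * f + f * f ≡ (τ + f) * (τ + f)
  lemma₂ = solve-∀
  lemma₃ : ∀ c → 2 * c * (2 * c) ≡ 4 * (c * c)
  lemma₃ = solve-∀
  lemma₄ : ∀ x c → 4 * (x + x + c) ≡ 8 * x + 2 * (2 * c)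
  lemma₄ = solve-∀

-- Evaluation over b < tri 14 = 91, that is, rows up to 13, and l ≤ tri 8 = 28. At b = 3 and l = 10
-- the inequality would read 14 ≤ 13, hence `4 ≤ b`.
superadditive-small : ∀ {b} → b < 91 → 4 ≤ b → ∀ {l} → l < 29 → 2 * proj₁ (pos b) < l → Superadditive b l
superadditive-small = toWitness {a? = allUpTo? (λ b → 4 ≤? b →-dec
  allUpTo? (λ l → 2 * proj₁ (pos b) <? l →-dec kk b + b + kk l ≤? kk (b + l)) 29) 91} tt

row-length : ∀ c e → e < c → proj₁ (pos (tri c + e)) ≡ c
row-length c e e<c = cong proj₁ (pos-row c e e<c)

superadditive-small′ : ∀ c e → e < c → c ≤ 13 → 4 ≤ tri c + e → ∀ l → l ≤ 28 → 2 * c < l →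
  Superadditive (tri c + e) l
superadditive-small′ c e e<c c≤13 4≤b l l≤28 2c<l = superadditive-small b<91 4≤b (s≤s l≤28)
  (subst (λ z → 2 * z < l) (sym (row-length c e e<c)) 2c<l)
  where
  b<91 : tri c + e < 91
  b<91 = ≤-trans (+-monoʳ-< (tri c) e<c)
    (≤-trans (≤-reflexive (+-comm (tri c) c)) (tri-mono (s≤s c≤13)))

-- For c ≤ 13, evaluation settles l ≤ 28 and `superadditive-row` continues from there. For larger c
-- let 2c lie in row q: up to `tri (suc q)` the value `kk l` is at most `tri c`, so
-- `superadditive-near` applies; beyond that point rows are appended as before.
superadditive : ∀ c e → e < c → 4 ≤ tri c + e → ∀ l → 2 * c < l → Superadditive (tri c + e) l
superadditive c e e<c 4≤b l 2c<l with c ≤? 13 | l ≤? 28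
... | yes c≤13 | yes l≤28 = superadditive-small′ c e e<c c≤13 4≤b l l≤28 2c<l
... | yes c≤13 | no l≰28 with row l
...   | d , t , t<d , refl = superadditive-row (tri c + e) 8 base (tri-cancel t<d (<⇒≤ (≰⇒> l≰28))) (<⇒≤ t<d)
  where
  base : Superadditive (tri c + e) (tri 8)
  -- 28 = tri 8 is the first triangular number above 2 * 13, so it is an admissible l for every c ≤
  -- 13.
  base = superadditive-small′ c e e<c c≤13 4≤b 28 ≤-refl (≤-trans (s≤s (*-monoʳ-≤ 2 c≤13)) (m≤n+m 27 1))
superadditive c e e<c 4≤b l 2c<l | no c≰13 | _ with row (2 * c)
... | q , f , f<q , 2c≡ = by-rows
  where
  open ≤-Reasoning
  8≤q : 8 ≤ q
  8≤q = tri-cancel f<q (≤-trans (*-monoʳ-≤ 2 (≰⇒> c≰13)) (≤-reflexive 2c≡))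
  tet≤ : kk (tri (suc q)) ≤ tri c
  tet≤ = ≤-trans (≤-reflexive (kk-tri (suc q)))
    (tet≤tri q c 8≤q (≤-trans (m≤m+n (tri q) f) (≤-reflexive (sym 2c≡))))
  2c<tri : 2 * c < tri (suc q)
  2c<tri = begin-strict
    2 * c     ≡⟨ 2c≡ ⟩
    tri q + f <⟨ +-monoʳ-< (tri q) f<q ⟩
    tri q + q ≡⟨ +-comm (tri q) q ⟩
    q + tri q ∎
  by-rows : Superadditive (tri c + e) l
  by-rows with ≤-total l (tri (suc q)) | row l
  ... | inj₁ l≤ | _ = superadditive-near c e l e<c 2c<l (≤-trans (kk-mono l≤) tet≤)
  ... | inj₂ l≥ | d , t , t<d , refl = superadditive-row (tri c + e) (suc q)
    (superadditive-near c e (tri (suc q)) e<c 2c<tri tet≤) (tri-cancel t<d l≥) (<⇒≤ t<d)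

-- For l = c + suc j the sum b + l either lies in row `suc c` (up to its end) or wraps into the row
-- after it. The first case uses the split of l at c, where the maximum is b; the second uses the
-- split at `suc c`, where the maximum is `tri (suc c)`.
kk-middle : ∀ c e j y → e < c → j ≤ c →
  y ≤ (tri c + e) ⊔ tri c + tri (suc j) → y ≤ (tri c + e) ⊔ tri (suc c) + tri j →
  kk (tri c + e) + y ≤ kk (tri c + e + (c + suc j))
kk-middle c e j y e<c j≤c y≤₁ y≤₂ with e + suc j ≤? suc c
... | yes fits = begin
  kk (tri c + e) + y
    ≤⟨ +-mono-≤ (≤-reflexive (kk-row c e (<⇒≤ e<c))) y≤₁ ⟩
  tet c + tri e + ((tri c + e) ⊔ tri c + tri (suc j))
    ≡⟨ cong (λ z → tet c + tri e + (z + tri (suc j))) (m≥n⇒m⊔n≡m (m≤m+n (tri c) e)) ⟩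
  tet c + tri e + (tri c + e + tri (suc j))
    ≤⟨ m≤m+n _ (e * j) ⟩
  tet c + tri e + (tri c + e + tri (suc j)) + e * j
    ≡⟨ lemma (tet c) (tri e) (tri c) e j (tri (suc j)) ⟩
  tri c + tet c + (tri e + tri (suc j) + e * suc j)
    ≡⟨ cong (tri c + tet c +_) (tri-+ e (suc j)) ⟨
  tet (suc c) + tri (e + suc j)
    ≡⟨ kk-row (suc c) (e + suc j) fits ⟨
  kk (c + tri c + (e + suc j))
    ≡⟨ cong kk (lemma₂ c (tri c) e j) ⟩
  kk (tri c + e + (c + suc j)) ∎
  where
  open ≤-Reasoning
  lemma : ∀ x y z e j w → x + y + (z + e + w) + e * j ≡ z + x + (y + w + e * suc j)
  lemma = solve-∀
  lemma₂ : ∀ c x e j → c + x + (e + suc j) ≡ x + e + (c + suc j)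
  lemma₂ = solve-∀
... | no wraps with w , c+w≡e+j ← m≤n⇒∃[o]m+o≡n {c} {e + j}
        (s≤s⁻¹ (≤-trans (s≤s⁻¹ (≤-trans (≰⇒> wraps) (≤-reflexive (+-suc e j)))) (n≤1+n _))) = begin
  kk (tri c + e) + y
    ≤⟨ +-mono-≤ (≤-reflexive (kk-row c e (<⇒≤ e<c))) y≤₂ ⟩
  tet c + tri e + ((tri c + e) ⊔ tri (suc c) + tri j)
    ≡⟨ cong (λ z → tet c + tri e + (z + tri j)) (m≤n⇒m⊔n≡n b≤) ⟩
  tet c + tri e + (tri (suc c) + tri j)
    ≡⟨ lemma (tet c) (tri e) (tri (suc c)) (tri j) ⟩
  tri (suc c) + tet c + (tri e + tri j)
    ≤⟨ +-monoʳ-≤ (tri (suc c) + tet c) (tri-majorize (<⇒≤ e<c) j≤c (sym c+w≡e+j)) ⟩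
  tri (suc c) + tet c + (tri c + tri w)
    ≡⟨ lemma₂ (tri (suc c)) (tet c) (tri c) (tri w) ⟩
  tet (suc (suc c)) + tri w
    ≡⟨ kk-row (suc (suc c)) w (≤-trans w≤c (m≤n+m c 2)) ⟨
  kk (suc c + (c + tri c) + w)
    ≡⟨ cong kk (trans (lemma₃ c (tri c) w) (cong (λ z → suc c + tri c + z) c+w≡e+j)) ⟩
  kk (suc c + tri c + (e + j))
    ≡⟨ cong kk (lemma₄ c (tri c) e j) ⟩
  kk (tri c + e + (c + suc j)) ∎
  where
  open ≤-Reasoning
  b≤ : tri c + e ≤ tri (suc c)
  b≤ = ≤-trans (+-monoʳ-≤ (tri c) (<⇒≤ e<c)) (≤-reflexive (+-comm (tri c) c))
  w≤c : w ≤ c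
  w≤c = +-cancelˡ-≤ c w c (≤-trans (≤-reflexive c+w≡e+j) (+-mono-≤ (<⇒≤ e<c) j≤c))
  lemma : ∀ x y z w → x + y + (z + w) ≡ z + x + (y + w)
  lemma = solve-∀
  lemma₂ : ∀ x y z w → x + y + (z + w) ≡ x + (z + y) + w
  lemma₂ = solve-∀
  lemma₃ : ∀ c x w → suc c + (c + x) + w ≡ suc c + x + (c + w)
  lemma₃ = solve-∀
  lemma₄ : ∀ c x e j → suc c + x + (e + j) ≡ x + e + (c + suc j)
  lemma₄ = solve-∀

-- Three regimes of l against the row length c of b: for l ≤ c the bound `tri l` suffices, for c < l
-- ≤ 2c the middle estimate is used, and for l > 2c superadditivity.
kk-split : ∀ b l y → 4 ≤ b → y ≤ tri l → (∀ c j → l ≡ c + j → y ≤ b ⊔ tri c + tri j) →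
  y ≤ b + kk l → kk b + y ≤ kk (b + l)
kk-split b l y 4≤b y≤tri middle y≤ with row b
... | c , e , e<c , refl with l ≤? c
...   | yes l≤c = ≤-trans (+-monoʳ-≤ (kk b) y≤tri) (kk-append-row c e l (<⇒≤ e<c) l≤c)
...   | no  l≰c with 2 * c <? l
...     | yes 2c<l = ≤-trans (+-monoʳ-≤ (kk b) y≤)
  (≤-trans (≤-reflexive (sym (+-assoc (kk b) b (kk l)))) (superadditive c e e<c 4≤b l 2c<l))
...     | no  2c≮l with j , refl ← m≤n⇒∃[o]m+o≡n (≰⇒> l≰c) =
  subst (λ z → kk b + y ≤ kk (b + z)) (+-suc c j)
    (kk-middle c e j y e<c j≤c (middle c (suc j) (sym (+-suc c j))) (middle (suc c) j refl))
  where
  j≤c : j ≤ c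
  j≤c = +-cancelˡ-≤ c j c (≤-trans (n≤1+n _)
    (≤-trans (≮⇒≥ 2c≮l) (≤-reflexive (cong (c +_) (+-identityʳ c)))))

-- Sets and the covering relation

pigeonhole : {xs ys : List X} → Unique xs → (∀ {x} → x ∈ₗ xs → x ∈ₗ ys) → length xs ≤ length ys
pigeonhole {xs = []}     _            _     = z≤n
pigeonhole {xs = x ∷ xs} u@(_ ∷ u′) xs⊆ys with as , bs , refl ← ∈-∃++ (xs⊆ys (here refl)) =
  subst (suc (length xs) ≤_) (sym (↭-length (shift x as bs)))
    (s≤s (pigeonhole u′ inside))
  where
  inside : ∀ {y} → y ∈ₗ xs → y ∈ₗ as ++ bs
  inside y∈xs with ∈-resp-↭ (shift x as bs) (xs⊆ys (there y∈xs))
  ... | here refl = contradiction y∈xs (Unique[x∷xs]⇒x∉xs u)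
  ... | there y∈  = y∈

increasing : ∀ S → AllPairs _<_ (elements S)
increasing (mkFinSet xs xs<) = recompute (allPairs? _<?_ xs) xs<

unique : ∀ S → Unique (elements S)
unique S = AllPairs.map <⇒≢ (increasing S)

-- The heads must agree: otherwise y is below every element of `x ∷ xs`, so that list embeds in
-- `ys`, which is too short.
increasing-≡ : ∀ {xs ys} → AllPairs _<_ xs → AllPairs _<_ ys → xs ⊆ₗ ys → length ys ≤ length xs → xs ≡ ys
increasing-≡ {[]}     {[]}     _ _ _ _ = refl
increasing-≡ {x ∷ xs} {[]}     _ _ xs⊆ys _ = contradiction (xs⊆ys (here refl)) λ ()
increasing-≡ {x ∷ xs} {y ∷ ys} (x< ∷ xs<) (y< ∷ ys<) xs⊆ys len with xs⊆ys (here refl)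
... | here refl = cong (x ∷_) (increasing-≡ xs< ys< tail (s≤s⁻¹ len))
  where
  tail : xs ⊆ₗ ys
  tail z∈ with xs⊆ys (there z∈)
  ... | here refl = contradiction (All.lookup x< z∈) (<-irrefl refl)
  ... | there z∈′ = z∈′
... | there x∈ys = contradiction (pigeonhole (AllPairs.map <⇒≢ (x< ∷ xs<)) tail) (<⇒≱ len)
  where
  y<all : ∀ {z} → z ∈ₗ x ∷ xs → y < z
  y<all (here refl) = All.lookup y< x∈ys
  y<all (there z∈)  = <-trans (All.lookup y< x∈ys) (All.lookup x< z∈)
  tail : (x ∷ xs) ⊆ₗ ys
  tail z∈ with xs⊆ys z∈
  ... | here refl = contradiction (y<all z∈) (<-irrefl refl)
  ... | there z∈′ = z∈′

elements-injective : ∀ {S T} → elements S ≡ elements T → S ≡ T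
elements-injective refl = refl

⊆⇒≡ : ∀ {S T} → S ⊆ T → ∣ T ∣ ≤ ∣ S ∣ → S ≡ T
⊆⇒≡ {S} {T} S⊆T len = elements-injective (increasing-≡ (increasing S) (increasing T) S⊆T len)

infix 4 _≟ˢ_ _⊆?_

_≟ˢ_ : DecidableEquality FinSet
S ≟ˢ T = map′ elements-injective (cong elements) (≡-dec _≟_ (elements S) (elements T))

_⊆?_ : ∀ S T → Dec (S ⊆ T)
S ⊆? T = elements S ⊆ₗ? elements T

⊈⇒∃ : ∀ {xs ys} → ¬ xs ⊆ₗ ys → ∃[ x ] x ∈ₗ xs × x ∉ₗ ys
⊈⇒∃ {xs} {ys} ⊈ with any? (λ x → ¬? (x ∈? ys)) xs
... | yes ∃x = find ∃x
... | no ∄x = ⊥-elim (⊈ inside)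
  where
  inside : xs ⊆ₗ ys
  inside {x} x∈ with x ∈? ys
  ... | yes p = p
  ... | no ¬p = contradiction (lose x∈ ¬p) ∄x

missing : ∀ {xs ys : List ℕ} → Unique xs → length ys < length xs → ∃[ x ] x ∈ₗ xs × x ∉ₗ ys
missing u lt = ⊈⇒∃ λ xs⊆ys → <⇒≱ lt (pigeonhole u xs⊆ys)

infix 4 _⋖_

record _⋖_ (B A : FinSet) : Set where
  constructor covers
  field
    below : B ⊆ A
    size  : ∣ A ∣ ≡ suc ∣ B ∣

open _⋖_

⋖-extra : ∀ {x y} → B ⋖ A → x ∈ₗ elements A → x ∉ₗ elements B → y ∈ₗ elements A → y ≡ x ⊎ y ∈ₗ elements B
⋖-extra {B} {A} {x} {y} (covers B⊆A ∣A∣≡) x∈A x∉B y∈A with y ≟ x | y ∈? elements B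
... | yes y≡x | _       = inj₁ y≡x
... | no  _   | yes y∈B = inj₂ y∈B
... | no  y≢x | no  y∉B = contradiction (pigeonhole xyB-unique xyB⊆A) (<⇒≱ (≤-reflexive (cong suc ∣A∣≡)))
  where
  fresh : ∀ {z} → z ∉ₗ elements B → All (z ≢_) (elements B)
  fresh z∉B = All.tabulate λ { w∈B refl → z∉B w∈B }
  xyB-unique : Unique (y ∷ x ∷ elements B)
  xyB-unique = (y≢x ∷ fresh y∉B) ∷ fresh x∉B ∷ unique B
  xyB⊆A : y ∷ x ∷ elements B ⊆ₗ elements A
  xyB⊆A (here refl)         = y∈A
  xyB⊆A (there (here refl)) = x∈A
  xyB⊆A (there (there z∈B)) = B⊆A z∈B

⋖-join : ∀ {x} → B ⋖ A → B ⋖ A′ → x ∈ₗ elements A → x ∈ₗ elements A′ → x ∉ₗ elements B → A ≡ A′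
⋖-join {B} {A} {A′} B⋖A B⋖A′ x∈A x∈A′ x∉B = ⊆⇒≡ A⊆A′ (≤-reflexive (size B⋖A′ ∙ sym (size B⋖A)))
  where
  A⊆A′ : A ⊆ A′
  A⊆A′ y∈A with ⋖-extra B⋖A x∈A x∉B y∈A
  ... | inj₁ refl = x∈A′
  ... | inj₂ y∈B  = below B⋖A′ y∈B

⋖-remove : ∀ {x} → B ⋖ A → B′ ⋖ A → x ∈ₗ elements A → x ∉ₗ elements B → x ∉ₗ elements B′ → B ≡ B′
⋖-remove {B} {A} {B′} B⋖A B′⋖A x∈A x∉B x∉B′ =
  sym (⊆⇒≡ B′⊆B (≤-reflexive (suc-injective (sym (size B⋖A) ∙ size B′⋖A))))
  where
  B′⊆B : B′ ⊆ B
  B′⊆B y∈B′ with ⋖-extra B⋖A x∈A x∉B (below B′⋖A y∈B′)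
  ... | inj₁ refl = contradiction y∈B′ x∉B′
  ... | inj₂ y∈B  = y∈B

-- Both covers are the union of B and B′. In geometric terms, sets of one size are points and the
-- sets covering them are lines: two points lie on at most one line.
⋖-two : B ⋖ A → B′ ⋖ A → B ⋖ A′ → B′ ⋖ A′ → B ≢ B′ → A ≡ A′
⋖-two {B} {A} {B′} B⋖A B′⋖A B⋖A′ B′⋖A′ B≢B′
  with x , x∈B′ , x∉B ← ⊈⇒∃ (λ B′⊆B → B≢B′ (sym (⊆⇒≡ B′⊆B
    (≤-reflexive (suc-injective (sym (size B⋖A) ∙ size B′⋖A))))))
  = ⋖-join B⋖A B⋖A′ (below B′⋖A x∈B′) (below B′⋖A′ x∈B′) x∉B

meet : FinSet → FinSet → List ℕ
meet S T = filter (_∈? elements T) (elements S)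

-- B loses at most the single point of A outside B′.
length-meet : B ⋖ A → B′ ⋖ A → ∣ B ∣ ≤ suc (length (meet B B′))
length-meet {B} {A} {B′} B⋖A B′⋖A
  with z , z∈A , z∉B′ ← missing {elements A} {elements B′} (unique A) (≤-reflexive (sym (size B′⋖A)))
  = pigeonhole (unique B) inside
  where
  inside : elements B ⊆ₗ z ∷ meet B B′
  inside y∈B with ⋖-extra B′⋖A z∈A z∉B′ (below B⋖A y∈B)
  ... | inj₁ refl = here refl
  ... | inj₂ y∈B′ = there (∈-filter⁺ (_∈? elements B′) y∈B y∈B′)

-- Each of the three sets is T without one point. Distinct sets omit distinct points, and no omitted
-- point lies in K.
no-three-above : ∀ {K A₁ A₂ A₃ T} → Unique K → A₁ ⋖ T → A₂ ⋖ T → A₃ ⋖ T →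
  A₁ ≢ A₂ → A₁ ≢ A₃ → A₂ ≢ A₃ → K ⊆ₗ elements A₁ → K ⊆ₗ elements A₂ → K ⊆ₗ elements A₃ →
  3 + length K ≤ ∣ T ∣
no-three-above {K} {A₁} {A₂} {A₃} {T} uC A₁⋖ A₂⋖ A₃⋖ ≢₁₂ ≢₁₃ ≢₂₃ K⊆₁ K⊆₂ K⊆₃
  with out A₁⋖ | out A₂⋖ | out A₃⋖
  where
  out : ∀ {A} → A ⋖ T → ∃[ z ] z ∈ₗ elements T × z ∉ₗ elements A
  out A⋖T = missing (unique T) (≤-reflexive (sym (size A⋖T)))
... | a , a∈ , a∉ | b , b∈ , b∉ | c , c∈ , c∉ = pigeonhole
  ((a≢b ∷ a≢c ∷ fresh {A = A₁} K⊆₁ a∉) ∷ (b≢c ∷ fresh {A = A₂} K⊆₂ b∉) ∷ fresh {A = A₃} K⊆₃ c∉ ∷ uC) inside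
  where
  a≢b : a ≢ b
  a≢b refl = ≢₁₂ (⋖-remove A₁⋖ A₂⋖ a∈ a∉ b∉)
  a≢c : a ≢ c
  a≢c refl = ≢₁₃ (⋖-remove A₁⋖ A₃⋖ a∈ a∉ c∉)
  b≢c : b ≢ c
  b≢c refl = ≢₂₃ (⋖-remove A₂⋖ A₃⋖ b∈ b∉ c∉)
  fresh : ∀ {z A} → K ⊆ₗ elements A → z ∉ₗ elements A → All (z ≢_) K
  fresh K⊆A z∉A = All.tabulate λ { w∈K refl → z∉A (K⊆A w∈K) }
  inside : a ∷ b ∷ c ∷ K ⊆ₗ elements T
  inside (here refl)                 = a∈
  inside (there (here refl))         = b∈
  inside (there (there (here refl))) = c∈
  inside (there (there (there w∈K))) = below A₁⋖ (K⊆₁ w∈K)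

-- Double counting

∑ : (X → ℕ) → List X → ℕ
∑ f []       = 0
∑ f (x ∷ xs) = f x + ∑ f xs

-- The Iverson bracket.
⟦_⟧ : Dec P → ℕ
⟦ yes _ ⟧ = 1
⟦ no _ ⟧  = 0

⟦⟧≤1 : (d : Dec P) → ⟦ d ⟧ ≤ 1
⟦⟧≤1 (yes _) = ≤-refl
⟦⟧≤1 (no _)  = z≤n

⟦⟧-yes : (d : Dec P) → P → ⟦ d ⟧ ≡ 1
⟦⟧-yes (yes _) _ = refl
⟦⟧-yes (no ¬p) p = contradiction p ¬p

⟦⟧-no : (d : Dec P) → ¬ P → ⟦ d ⟧ ≡ 0
⟦⟧-no (yes p) ¬p = contradiction p ¬p
⟦⟧-no (no _)  _  = refl

⟦⟧-× : (d : Dec P) (e : Dec Q) → ⟦ d ⟧ * ⟦ e ⟧ ≡ ⟦ d ×-dec e ⟧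
⟦⟧-× (yes _) (yes _) = refl
⟦⟧-× (yes _) (no _)  = refl
⟦⟧-× (no _)  (yes _) = refl
⟦⟧-× (no _)  (no _)  = refl

1≤⟦⟧-× : (d : Dec P) (e : Dec Q) → P → Q → 1 ≤ ⟦ d ×-dec e ⟧
1≤⟦⟧-× d e p q = ≤-reflexive (sym (⟦⟧-yes (d ×-dec e) (p , q)))

∑-mono : ∀ {f g : X → ℕ} xs → (∀ {x} → x ∈ₗ xs → f x ≤ g x) → ∑ f xs ≤ ∑ g xs
∑-mono []       _ = z≤n
∑-mono (x ∷ xs) h = +-mono-≤ (h (here refl)) (∑-mono xs (h ∘ there))

∑-cong : ∀ {f g : X → ℕ} xs → (∀ {x} → x ∈ₗ xs → f x ≡ g x) → ∑ f xs ≡ ∑ g xs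
∑-cong []       _ = refl
∑-cong (x ∷ xs) h = cong₂ _+_ (h (here refl)) (∑-cong xs (h ∘ there))

∑-+ : ∀ (f g : X → ℕ) xs → ∑ (λ x → f x + g x) xs ≡ ∑ f xs + ∑ g xs
∑-+ f g []       = refl
∑-+ f g (x ∷ xs) = cong (f x + g x +_) (∑-+ f g xs) ∙ lemma (f x) (g x) (∑ f xs) (∑ g xs)
  where
  lemma : ∀ a b c d → a + b + (c + d) ≡ a + c + (b + d)
  lemma = solve-∀

∑-const : ∀ k (xs : List X) → ∑ (λ _ → k) xs ≡ k * length xs
∑-const k []       = sym (*-zeroʳ k)
∑-const k (x ∷ xs) = cong (k +_) (∑-const k xs) ∙ sym (*-suc k (length xs))

∑-* : ∀ k (f : X → ℕ) xs → ∑ (λ x → k * f x) xs ≡ k * ∑ f xs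
∑-* k f []       = sym (*-zeroʳ k)
∑-* k f (x ∷ xs) = cong (k * f x +_) (∑-* k f xs) ∙ sym (*-distribˡ-+ k (f x) (∑ f xs))

∑-swap : ∀ (f : X → Y → ℕ) xs ys → ∑ (λ x → ∑ (f x) ys) xs ≡ ∑ (λ y → ∑ (λ x → f x y) xs) ys
∑-swap f []       ys = sym (∑-const 0 ys)
∑-swap f (x ∷ xs) ys = cong (∑ (f x) ys +_) (∑-swap f xs ys) ∙ sym (∑-+ (f x) _ ys)

∑-↭ : ∀ (f : X → ℕ) {xs ys} → xs ↭ ys → ∑ f xs ≡ ∑ f ys
∑-↭ f refl         = refl
∑-↭ f (prep x p)   = cong (f x +_) (∑-↭ f p)
∑-↭ f (swap x y p) = cong (λ z → f x + (f y + z)) (∑-↭ f p) ∙ lemma (f x) (f y) _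
  where
  lemma : ∀ a b c → a + (b + c) ≡ b + (a + c)
  lemma = solve-∀
∑-↭ f (trans↭ p q)  = ∑-↭ f p ∙ ∑-↭ f q

∑-split : ∀ {P : X → Set} (P? : Decidable P) (f : X → ℕ) xs →
  ∑ f xs ≡ ∑ f (filter P? xs) + ∑ f (filter (¬? ∘ P?) xs)
∑-split P? f []       = refl
∑-split P? f (x ∷ xs) with P? x
... | yes _ = cong (f x +_) (∑-split P? f xs) ∙ sym (+-assoc (f x) _ _)
... | no  _ = cong (f x +_) (∑-split P? f xs) ∙ lemma (f x) (∑ f (filter P? xs)) (∑ f (filter (¬? ∘ P?) xs))
  where
  lemma : ∀ a b c → a + (b + c) ≡ b + (a + c)
  lemma = solve-∀

length≡∑ : (xs : List X) → length xs ≡ ∑ (λ _ → 1) xs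
length≡∑ xs = sym (∑-const 1 xs ∙ *-identityˡ _)

length-split : ∀ {P : X → Set} (P? : Decidable P) xs →
  length xs ≡ length (filter P? xs) + length (filter (¬? ∘ P?) xs)
length-split P? xs = length≡∑ xs ∙ (∑-split P? (λ _ → 1) xs ∙
  cong₂ _+_ (sym (length≡∑ (filter P? xs))) (sym (length≡∑ (filter (¬? ∘ P?) xs))))

length-filter≡∑ : ∀ {P : X → Set} (P? : Decidable P) xs → length (filter P? xs) ≡ ∑ (⟦_⟧ ∘ P?) xs
length-filter≡∑ P? []       = refl
length-filter≡∑ P? (x ∷ xs) with P? x
... | yes _ = cong suc (length-filter≡∑ P? xs)
... | no  _ = length-filter≡∑ P? xs

∑-none : ∀ {f : X → ℕ} xs → (∀ {x} → x ∈ₗ xs → f x ≡ 0) → ∑ f xs ≡ 0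
∑-none xs h = ∑-cong xs h ∙ ∑-const 0 xs

∑-at-most-one : ∀ {P : X → Set} (P? : Decidable P) {xs} → Unique xs →
  (∀ {x y} → x ∈ₗ xs → y ∈ₗ xs → P x → P y → x ≡ y) → ∑ (⟦_⟧ ∘ P?) xs ≤ 1
∑-at-most-one P? {[]}     _         _ = z≤n
∑-at-most-one P? {x ∷ xs} u@(_ ∷ u′) h with P? x
... | no  _  = ∑-at-most-one P? u′ λ x∈ y∈ → h (there x∈) (there y∈)
... | yes px = s≤s (≤-reflexive (∑-none xs λ {y} y∈ → ⟦⟧-no (P? y) λ py →
  contradiction (subst (_∈ₗ xs) (sym (h (here refl) (there y∈) px py)) y∈) (Unique[x∷xs]⇒x∉xs u)))

∑-only : ∀ {P : X → Set} (P? : Decidable P) (f : X → ℕ) {xs k} → Unique xs →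
  (∀ {x y} → x ∈ₗ xs → y ∈ₗ xs → P x → P y → x ≡ y) → (∀ {x} → P x → f x ≤ k) →
  ∑ (λ x → ⟦ P? x ⟧ * f x) xs ≤ k
∑-only P? f {xs} {k} u h f≤k = begin
  ∑ (λ x → ⟦ P? x ⟧ * f x) xs ≤⟨ ∑-mono xs (λ {x} _ → pointwise x) ⟩
  ∑ (λ x → k * ⟦ P? x ⟧) xs   ≡⟨ ∑-* k _ xs ⟩
  k * ∑ (⟦_⟧ ∘ P?) xs         ≤⟨ *-monoʳ-≤ k (∑-at-most-one P? u h) ⟩
  k * 1                       ≡⟨ *-identityʳ k ⟩
  k                           ∎
  where
  open ≤-Reasoning
  pointwise : ∀ x → ⟦ P? x ⟧ * f x ≤ k * ⟦ P? x ⟧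
  pointwise x with P? x
  ... | yes px = ≤-trans (≤-reflexive (+-identityʳ _)) (≤-trans (f≤k px) (≤-reflexive (sym (*-identityʳ k))))
  ... | no  _  = z≤n

pick : ∀ {P : X → Set} (P? : Decidable P) xs → 1 ≤ ∑ (⟦_⟧ ∘ P?) xs →
  ∃₂ λ x xs′ → xs ↭ x ∷ xs′ × P x
pick P? (x ∷ xs) le with P? x
... | yes px = x , xs , refl , px
... | no  _  with y , ys , xs↭ , py ← pick P? xs le = y , x ∷ ys , ↭-trans (prep x xs↭) (swap x y refl) , py

pick-rest : ∀ {P : X → Set} (P? : Decidable P) {k xs x xs′} → xs ↭ x ∷ xs′ → suc k ≤ ∑ (⟦_⟧ ∘ P?) xs →
  k ≤ ∑ (⟦_⟧ ∘ P?) xs′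
pick-rest P? {k} {xs} {x} {xs′} xs↭ le = s≤s⁻¹ (begin
  suc k                            ≤⟨ le ⟩
  ∑ (⟦_⟧ ∘ P?) xs                  ≡⟨ ∑-↭ _ xs↭ ⟩
  ⟦ P? x ⟧ + ∑ (⟦_⟧ ∘ P?) xs′      ≤⟨ +-monoˡ-≤ _ (⟦⟧≤1 (P? x)) ⟩
  suc (∑ (⟦_⟧ ∘ P?) xs′)           ∎)
  where open ≤-Reasoning

pick₂ : ∀ {P : X → Set} (P? : Decidable P) xs → 2 ≤ ∑ (⟦_⟧ ∘ P?) xs →
  ∃₂ λ x y → ∃ λ xs′ → xs ↭ x ∷ y ∷ xs′ × P x × P y
pick₂ P? xs le
  with x , ys , xs↭ , px ← pick P? xs (≤-trans (s≤s z≤n) le)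
  with y , zs , ys↭ , py ← pick P? ys (pick-rest P? xs↭ le)
  = x , y , zs , ↭-trans xs↭ (prep x ys↭) , px , py

pick₃ : ∀ {P : X → Set} (P? : Decidable P) xs → 3 ≤ ∑ (⟦_⟧ ∘ P?) xs →
  ∃₂ λ x y → ∃₂ λ z xs′ → xs ↭ x ∷ y ∷ z ∷ xs′ × P x × P y × P z
pick₃ P? xs le
  with x , ys , xs↭ , px ← pick P? xs (≤-trans (s≤s z≤n) le)
  with y , z , zs , ys↭ , py , pz ← pick₂ P? ys (pick-rest P? xs↭ le)
  = x , y , z , zs , ↭-trans xs↭ (prep x ys↭) , px , py , pz

-- Incidences between two consecutive layers

infix 8 _#_

_#_ : List FinSet → FinSet → ℕ
L # T = ∑ (λ M → ⟦ M ⊆? T ⟧) L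

∑-weighted : ∀ (p : FinSet → ℕ) L Ts →
  ∑ (λ T → p T * L # T) Ts ≡ ∑ (λ M → ∑ (λ T → p T * ⟦ M ⊆? T ⟧) Ts) L
∑-weighted p L Ts = ∑-cong Ts (λ {T} _ → sym (∑-* (p T) _ L)) ∙ ∑-swap (λ T M → p T * ⟦ M ⊆? T ⟧) Ts L

record Layers (s : ℕ) (L Ts : List FinSet) : Set where
  field
    L-unique  : Unique L
    L-size    : ∀ {M} → M ∈ₗ L → ∣ M ∣ ≡ s
    Ts-unique : Unique Ts
    Ts-size   : ∀ {T} → T ∈ₗ Ts → ∣ T ∣ ≡ suc s

  cover : ∀ {M T} → M ∈ₗ L → T ∈ₗ Ts → M ⊆ T → M ⋖ T
  cover M∈ T∈ M⊆T = covers M⊆T (Ts-size T∈ ∙ cong suc (sym (L-size M∈)))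

open Layers

module _ {s L Ts} (layers : Layers s L Ts) where
  layers-↭ : ∀ {L′} → L ↭ L′ → Layers s L′ Ts
  layers-↭ p .L-unique    = Unique-resp-↭ (↭⇒↭ₛ p) (L-unique layers)
  layers-↭ p .L-size M∈   = L-size layers (∈-resp-↭ (↭-sym p) M∈)
  layers-↭ p .Ts-unique   = Ts-unique layers
  layers-↭ p .Ts-size     = Ts-size layers

  layers-filter : ∀ {P : FinSet → Set} (P? : Decidable P) → Layers s (filter P? L) Ts
  layers-filter P? .L-unique  = unique-filter P? (L-unique layers)
  layers-filter P? .L-size M∈ = L-size layers (proj₁ (∈-filter⁻ P? M∈))
  layers-filter P? .Ts-unique = Ts-unique layers
  layers-filter P? .Ts-size   = Ts-size layers

  layers-filterᵀ : ∀ {P : FinSet → Set} (P? : Decidable P) → Layers s L (filter P? Ts)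
  layers-filterᵀ P? .L-unique  = L-unique layers
  layers-filterᵀ P? .L-size    = L-size layers
  layers-filterᵀ P? .Ts-unique = unique-filter P? (Ts-unique layers)
  layers-filterᵀ P? .Ts-size T∈ = Ts-size layers (proj₁ (∈-filter⁻ P? T∈))

layers-tail : ∀ {s M L Ts} → Layers s (M ∷ L) Ts → Layers s L Ts
layers-tail l .L-unique with _ ∷ u ← L-unique l = u
layers-tail l .L-size M∈   = L-size l (there M∈)
layers-tail l .Ts-unique   = Ts-unique l
layers-tail l .Ts-size     = Ts-size l

head≢ : ∀ {s M M′ L Ts} → Layers s (M ∷ L) Ts → M′ ∈ₗ L → M ≢ M′
head≢ l M′∈ refl = Unique[x∷xs]⇒x∉xs (L-unique l) M′∈

∑-pair≤1 : ∀ {s M M′ L Ts} → Layers s L Ts → M ∈ₗ L → M′ ∈ₗ L → M ≢ M′ →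
  ∑ (λ T → ⟦ M ⊆? T ⟧ * ⟦ M′ ⊆? T ⟧) Ts ≤ 1
∑-pair≤1 {M = M} {M′} {L} {Ts} l M∈ M′∈ M≢M′ = begin
  ∑ (λ T → ⟦ M ⊆? T ⟧ * ⟦ M′ ⊆? T ⟧) Ts      ≡⟨ ∑-cong Ts (λ {T} _ → ⟦⟧-× (M ⊆? T) (M′ ⊆? T)) ⟩
  ∑ (λ T → ⟦ M ⊆? T ×-dec M′ ⊆? T ⟧) Ts      ≤⟨ ∑-at-most-one (λ T → M ⊆? T ×-dec M′ ⊆? T) (Ts-unique l)
    (λ T∈ T′∈ (a , b) (a′ , b′) → ⋖-two (cover l M∈ T∈ a) (cover l M′∈ T∈ b) (cover l M∈ T′∈ a′) (cover l M′∈ T′∈ b′) M≢M′) ⟩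
  1 ∎
  where open ≤-Reasoning

-- `tri (L # T)` counts the pairs of members of L inside T, and by `⋖-two` a pair lies in at most
-- one T.
∑-tri : ∀ {s} L {Ts} → Layers s L Ts → ∑ (λ T → tri (L # T)) Ts ≤ tri (length L)
∑-tri []      {Ts} _ = ≤-reflexive (∑-const 0 Ts)
∑-tri (M ∷ L) {Ts} l = begin
  ∑ (λ T → tri ((M ∷ L) # T)) Ts
    ≡⟨ ∑-cong Ts (λ {T} _ → split (M ⊆? T) (L # T)) ⟩
  ∑ (λ T → ⟦ M ⊆? T ⟧ * L # T + tri (L # T)) Ts
    ≡⟨ ∑-+ _ _ Ts ⟩
  ∑ (λ T → ⟦ M ⊆? T ⟧ * L # T) Ts + ∑ (λ T → tri (L # T)) Ts
    ≡⟨ cong (_+ ∑ (λ T → tri (L # T)) Ts) (∑-weighted (λ T → ⟦ M ⊆? T ⟧) L Ts) ⟩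
  ∑ (λ M′ → ∑ (λ T → ⟦ M ⊆? T ⟧ * ⟦ M′ ⊆? T ⟧) Ts) L + ∑ (λ T → tri (L # T)) Ts
    ≤⟨ +-mono-≤ (∑-mono L (λ M′∈ → ∑-pair≤1 l (here refl) (there M′∈) (head≢ l M′∈))) (∑-tri L (layers-tail l)) ⟩
  ∑ (λ _ → 1) L + tri (length L)
    ≡⟨ cong (_+ tri (length L)) (length≡∑ L) ⟨
  length L + tri (length L) ∎
  where
  open ≤-Reasoning
  split : (d : Dec P) → ∀ n → tri (⟦ d ⟧ + n) ≡ ⟦ d ⟧ * n + tri n
  split (yes _) n = cong (_+ tri n) (sym (+-identityʳ n))
  split (no _)  n = refl

-- Stars

-- `weight` counts a line once for having two points and once more for having three. Adding y ≤ s₂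
-- and y ≤ b + s₃ then turns every upper bound on the total weight `V` into one on 2y.
atLeast₂ atLeast₃ weight : ℕ → ℕ
atLeast₂ (suc (suc _))       = 1
atLeast₂ _                   = 0
atLeast₃ (suc (suc (suc _))) = 1
atLeast₃ _                   = 0
weight n = atLeast₂ n + atLeast₃ n

s₂ s₃ V : List FinSet → List FinSet → ℕ
s₂ L Ts = ∑ (λ T → atLeast₂ (L # T)) Ts
s₃ L Ts = ∑ (λ T → atLeast₃ (L # T)) Ts
V  L Ts = ∑ (λ T → weight (L # T)) Ts

V≡ : ∀ L Ts → V L Ts ≡ s₂ L Ts + s₃ L Ts
V≡ L Ts = ∑-+ _ _ Ts

atLeast₂≤tri : ∀ n → atLeast₂ n ≤ tri n
atLeast₂≤tri zero                = z≤n
atLeast₂≤tri (suc zero)          = z≤n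
atLeast₂≤tri (suc (suc n))       = s≤s z≤n

weight≤tri : ∀ n → weight n ≤ tri n
weight≤tri zero                = z≤n
weight≤tri (suc zero)          = z≤n
weight≤tri (suc (suc zero))    = s≤s z≤n
weight≤tri (suc (suc (suc n))) = s≤s (≤-trans (s≤s z≤n) (m≤n+m _ (suc n)))

s₂≤tri : ∀ {s L Ts} → Layers s L Ts → s₂ L Ts ≤ tri (length L)
s₂≤tri {L = L} {Ts} l = ≤-trans (∑-mono Ts (λ {T} _ → atLeast₂≤tri (L # T))) (∑-tri L l)

V≤tri : ∀ {s L Ts} → Layers s L Ts → V L Ts ≤ tri (length L)
V≤tri {L = L} {Ts} l = ≤-trans (∑-mono Ts (λ {T} _ → weight≤tri (L # T))) (∑-tri L l)

s₃≤tri : ∀ {s L Ts} → Layers s L Ts → s₃ L Ts ≤ tri (length L)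
s₃≤tri {L = L} {Ts} l = ≤-trans (≤-trans (m≤n+m _ _) (≤-reflexive (sym (V≡ L Ts)))) (V≤tri l)

weight-small : ∀ {n} → ¬ 2 ≤ n → weight n ≡ 0
weight-small {zero}        _  = refl
weight-small {suc zero}    _  = refl
weight-small {suc (suc n)} ¬p = contradiction (s≤s (s≤s z≤n)) ¬p

inStar : (K : List ℕ) → Decidable (λ M → K ⊆ₗ elements M)
inStar K M = K ⊆ₗ? elements M

star : List ℕ → List FinSet → ℕ
star K L = ∑ (⟦_⟧ ∘ inStar K) L

-- S is the star of K and J the rest. Since K has at least s - 1 points, `no-three-above` allows at
-- most two members of S in any T. A T that does not contain K has none of them, and a member of J
-- lies in at most one T containing K.
module StarPeel {s L Ts} (l : Layers s L Ts) {K : List ℕ} (K-unique : Unique K) (s≤ : s ≤ suc (length K)) where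
  S J : List FinSet
  S = filter (inStar K) L
  J = filter (¬? ∘ inStar K) L

  lS : Layers s S Ts
  lS = layers-filter l (inStar K)

  lJ : Layers s J Ts
  lJ = layers-filter l (¬? ∘ inStar K)

  inside : ∀ {M} → M ∈ₗ S → K ⊆ₗ elements M
  inside M∈ = proj₂ (∈-filter⁻ (inStar K) {xs = L} M∈)

  outside : ∀ {M} → M ∈ₗ J → ¬ K ⊆ₗ elements M
  outside M∈ = proj₂ (∈-filter⁻ (¬? ∘ inStar K) {xs = L} M∈)

  S#≤2 : ∀ {T} → T ∈ₗ Ts → S # T ≤ 2
  S#≤2 {T} T∈ with S # T ≤? 2
  ... | yes p = p
  ... | no ¬p with M₁ , M₂ , M₃ , _ , S↭ , ⊆₁ , ⊆₂ , ⊆₃ ← pick₃ (_⊆? T) S (≰⇒> ¬p) =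
    contradiction (begin-strict
      ∣ T ∣           ≡⟨ Ts-size l T∈ ⟩
      suc s           ≤⟨ s≤s s≤ ⟩
      2 + length K    <⟨ ≤-refl ⟩
      3 + length K    ≤⟨ no-three-above K-unique (cover l′ (here refl) T∈ ⊆₁)
        (cover l′ (there (here refl)) T∈ ⊆₂) (cover l′ (there (there (here refl))) T∈ ⊆₃)
        (head≢ l′ (here refl)) (head≢ l′ (there (here refl))) (head≢ (layers-tail l′) (here refl))
        (inside (∈-resp-↭ (↭-sym S↭) (here refl)))
        (inside (∈-resp-↭ (↭-sym S↭) (there (here refl))))
        (inside (∈-resp-↭ (↭-sym S↭) (there (there (here refl))))) ⟩
      ∣ T ∣           ∎) (<-irrefl refl)
    where
    open ≤-Reasoning
    l′ = layers-↭ lS S↭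

  S#≡0 : ∀ {T} → ¬ K ⊆ₗ elements T → S # T ≡ 0
  S#≡0 {T} K⊈T = ∑-none S (λ {M} M∈ → ⟦⟧-no (M ⊆? T) (λ M⊆T → K⊈T (λ z∈ → M⊆T (inside M∈ z∈))))

  J-once : ∀ {M} → M ∈ₗ J → ∑ (λ T → ⟦ inStar K T ⟧ * ⟦ M ⊆? T ⟧) Ts ≤ 1
  J-once {M} M∈ with y , y∈K , y∉M ← ⊈⇒∃ (outside M∈) = begin
    ∑ (λ T → ⟦ inStar K T ⟧ * ⟦ M ⊆? T ⟧) Ts ≡⟨ ∑-cong Ts (λ {T} _ → ⟦⟧-× (inStar K T) (M ⊆? T)) ⟩
    ∑ (λ T → ⟦ inStar K T ×-dec M ⊆? T ⟧) Ts ≤⟨ ∑-at-most-one (λ T → inStar K T ×-dec M ⊆? T) (Ts-unique l)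
      (λ T∈ T′∈ (K⊆T , M⊆T) (K⊆T′ , M⊆T′) → ⋖-join (cover lJ M∈ T∈ M⊆T) (cover lJ M∈ T′∈ M⊆T′) (K⊆T y∈K) (K⊆T′ y∈K) y∉M) ⟩
    1 ∎
    where open ≤-Reasoning

  ∑J≤ : ∑ (λ T → ⟦ inStar K T ⟧ * J # T) Ts ≤ length J
  ∑J≤ = begin
    ∑ (λ T → ⟦ inStar K T ⟧ * J # T) Ts ≡⟨ ∑-weighted (λ T → ⟦ inStar K T ⟧) J Ts ⟩
    ∑ (λ M → ∑ (λ T → ⟦ inStar K T ⟧ * ⟦ M ⊆? T ⟧) Ts) J ≤⟨ ∑-mono J J-once ⟩
    ∑ (λ _ → 1) J                       ≡⟨ length≡∑ J ⟨
    length J                            ∎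
    where open ≤-Reasoning

  -- `tri a` pays for a line spanned by two star members, and d for the members of J on the line.
  weight-peel : ∀ a d → a ≤ 2 → weight (a + d) ≤ weight d + (tri a + d)
  weight-peel zero             d                   _ = m≤m+n _ _
  weight-peel (suc zero)       zero                _ = z≤n
  weight-peel (suc zero)       (suc zero)          _ = s≤s z≤n
  weight-peel (suc zero)       (suc (suc zero))    _ = s≤s (s≤s z≤n)
  weight-peel (suc zero)       (suc (suc (suc d))) _ = m≤m+n _ _
  weight-peel (suc (suc zero)) zero                _ = s≤s z≤n
  weight-peel (suc (suc zero)) (suc zero)          _ = s≤s (s≤s z≤n)
  weight-peel (suc (suc zero)) (suc (suc d))       _ = ≤-trans (s≤s (s≤s z≤n)) (m≤n+m _ (weight (suc (suc d))))
  weight-peel (suc (suc (suc _))) _ (s≤s (s≤s ()))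

  atLeast₃-peel : ∀ a d → a ≤ 2 → atLeast₃ (a + d) ≤ atLeast₃ d + d
  atLeast₃-peel zero             d                   _ = m≤m+n _ _
  atLeast₃-peel (suc zero)       zero                _ = z≤n
  atLeast₃-peel (suc zero)       (suc zero)          _ = z≤n
  atLeast₃-peel (suc zero)       (suc (suc zero))    _ = s≤s z≤n
  atLeast₃-peel (suc zero)       (suc (suc (suc d))) _ = m≤m+n _ _
  atLeast₃-peel (suc (suc zero)) zero                _ = z≤n
  atLeast₃-peel (suc (suc zero)) (suc d)             _ = ≤-trans (s≤s z≤n) (m≤n+m _ (atLeast₃ (suc d)))
  atLeast₃-peel (suc (suc (suc _))) _ (s≤s (s≤s ()))

  V-peel : V L Ts ≤ V J Ts + (tri (length S) + length J)
  V-peel = begin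
    V L Ts
      ≤⟨ ∑-mono Ts pointwise ⟩
    ∑ (λ T → weight (J # T) + (tri (S # T) + ⟦ inStar K T ⟧ * J # T)) Ts
      ≡⟨ ∑-+ _ _ Ts ∙ cong (V J Ts +_) (∑-+ _ _ Ts) ⟩
    V J Ts + (∑ (λ T → tri (S # T)) Ts + ∑ (λ T → ⟦ inStar K T ⟧ * J # T) Ts)
      ≤⟨ +-monoʳ-≤ (V J Ts) (+-mono-≤ (∑-tri S lS) ∑J≤) ⟩
    V J Ts + (tri (length S) + length J) ∎
    where
    open ≤-Reasoning
    pointwise : ∀ {T} → T ∈ₗ Ts → weight (L # T) ≤ weight (J # T) + (tri (S # T) + ⟦ inStar K T ⟧ * J # T)
    pointwise {T} T∈ rewrite ∑-split (inStar K) (λ M → ⟦ M ⊆? T ⟧) L with inStar K T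
    ... | yes _   rewrite +-identityʳ (J # T) = weight-peel (S # T) (J # T) (S#≤2 T∈)
    ... | no K⊈T rewrite S#≡0 {T} K⊈T = m≤m+n _ _

  -- No `tri` term arises, because two star members alone do not make a line with three points.
  s₃-peel : s₃ L Ts ≤ s₃ J Ts + length J
  s₃-peel = begin
    s₃ L Ts
      ≤⟨ ∑-mono Ts pointwise ⟩
    ∑ (λ T → atLeast₃ (J # T) + ⟦ inStar K T ⟧ * J # T) Ts
      ≡⟨ ∑-+ _ _ Ts ⟩
    s₃ J Ts + ∑ (λ T → ⟦ inStar K T ⟧ * J # T) Ts
      ≤⟨ +-monoʳ-≤ (s₃ J Ts) ∑J≤ ⟩
    s₃ J Ts + length J ∎
    where
    open ≤-Reasoning
    pointwise : ∀ {T} → T ∈ₗ Ts → atLeast₃ (L # T) ≤ atLeast₃ (J # T) + ⟦ inStar K T ⟧ * J # T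
    pointwise {T} T∈ rewrite ∑-split (inStar K) (λ M → ⟦ M ⊆? T ⟧) L with inStar K T
    ... | yes _   rewrite +-identityʳ (J # T) = atLeast₃-peel (S # T) (J # T) (S#≤2 T∈)
    ... | no K⊈T rewrite S#≡0 {T} K⊈T = m≤m+n _ _

  lengths : length L ≡ length S + length J
  lengths = length-split (inStar K) L

-- `T₀` is the only line containing both `M₁` and `M₂`, so every other line loses at most one point
-- when they are removed. The factors `e` and `ne` separate the two cases.
module EdgePeel {s M₁ M₂ L Ts} (l : Layers s (M₁ ∷ M₂ ∷ L) Ts) {T₀} (T₀∈ : T₀ ∈ₗ Ts)
                (M₁⊆ : M₁ ⊆ T₀) (M₂⊆ : M₂ ⊆ T₀) where
  K : List ℕ
  K = meet M₁ M₂

  M₁≢M₂ : M₁ ≢ M₂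
  M₁≢M₂ = head≢ l (here refl)

  e ne : FinSet → ℕ
  e T = ⟦ T ≟ˢ T₀ ⟧
  ne T = ⟦ ¬? (T ≟ˢ T₀) ⟧

  ends : FinSet → ℕ
  ends T = ⟦ M₁ ⊆? T ⟧ + ⟦ M₂ ⊆? T ⟧

  cover₁ : ∀ {T} → T ∈ₗ Ts → M₁ ⊆ T → M₁ ⋖ T
  cover₁ = cover l (here refl)

  cover₂ : ∀ {T} → T ∈ₗ Ts → M₂ ⊆ T → M₂ ⋖ T
  cover₂ = cover l (there (here refl))

  weight-step : ∀ d → weight (suc d) ≤ weight d + (d + 0)
  weight-step zero                = z≤n
  weight-step (suc zero)          = s≤s z≤n
  weight-step (suc (suc zero))    = s≤s (s≤s z≤n)
  weight-step (suc (suc (suc d))) = m≤m+n _ _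

  weight-≤2 : ∀ n → weight n ≤ 2
  weight-≤2 zero                = z≤n
  weight-≤2 (suc zero)          = z≤n
  weight-≤2 (suc (suc zero))    = s≤s z≤n
  weight-≤2 (suc (suc (suc _))) = ≤-refl

  weight-two : ∀ d → weight (suc (suc d)) ≤ weight d + suc d
  weight-two zero    = s≤s z≤n
  weight-two (suc d) = ≤-trans (weight-≤2 (3 + d)) (≤-trans (s≤s (s≤s z≤n)) (m≤n+m _ (weight (suc d))))

  pointwise : ∀ {T} → T ∈ₗ Ts →
    weight ((M₁ ∷ M₂ ∷ L) # T) ≤ weight (L # T) + (e T * suc (L # T) + (ne T * ends T) * L # T)
  pointwise {T} T∈ with T ≟ˢ T₀
  ... | yes refl rewrite ⟦⟧-yes (M₁ ⊆? T) M₁⊆ | ⟦⟧-yes (M₂ ⊆? T) M₂⊆ | +-identityʳ (L # T) | +-identityʳ (suc (L # T)) =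
    weight-two (L # T)
  ... | no T≢T₀ with M₁ ⊆? T | M₂ ⊆? T
  ...   | yes p | yes q = contradiction (⋖-two (cover₁ T∈ p) (cover₂ T∈ q) (cover₁ T₀∈ M₁⊆) (cover₂ T₀∈ M₂⊆) M₁≢M₂) T≢T₀
  ...   | yes _ | no _  = weight-step (L # T)
  ...   | no _  | yes _ = weight-step (L # T)
  ...   | no _  | no _  = m≤m+n _ _

  K⊆₁ : K ⊆ₗ elements M₁
  K⊆₁ z∈ = proj₁ (∈-filter⁻ (_∈? elements M₂) z∈)

  K⊆₂ : K ⊆ₗ elements M₂
  K⊆₂ z∈ = proj₂ (∈-filter⁻ (_∈? elements M₂) {xs = elements M₁} z∈)

  -- Two lines other than T₀ through M₁ and M₂ respectively meet in M only if
  -- M lies in the star of M₁ ∩ M₂.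
  inner : ∀ {M} → M ∈ₗ L → ⟦ M ⊆? T₀ ⟧ + ∑ (λ T → (ne T * ends T) * ⟦ M ⊆? T ⟧) Ts ≤ 1 + ⟦ inStar K M ⟧
  inner {M} M∈ with M ⊆? T₀
  ... | yes M⊆ = ≤-trans (≤-reflexive (cong suc (∑-none Ts zero-term))) (s≤s z≤n)
    where
    zero-term : ∀ {T} → T ∈ₗ Ts → (ne T * ends T) * ⟦ M ⊆? T ⟧ ≡ 0
    zero-term {T} T∈ with T ≟ˢ T₀ | M₁ ⊆? T | M₂ ⊆? T | M ⊆? T
    ... | yes _ | _ | _ | _ = refl
    ... | no ≢ | yes p | _ | yes q = contradiction (⋖-two (cover₁ T∈ p) (cover l (there (there M∈)) T∈ q)
                  (cover₁ T₀∈ M₁⊆) (cover l (there (there M∈)) T₀∈ M⊆) (head≢ l (there M∈))) ≢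
    ... | no ≢ | no _ | yes p | yes q = contradiction (⋖-two (cover₂ T∈ p) (cover l (there (there M∈)) T∈ q)
                  (cover₂ T₀∈ M₂⊆) (cover l (there (there M∈)) T₀∈ M⊆) (head≢ (layers-tail l) M∈)) ≢
    ... | no _ | no _ | no _ | _ = refl
    ... | no _ | yes _ | yes _ | no _ = refl
    ... | no _ | yes _ | no _ | no _ = refl
    ... | no _ | no _ | yes _ | no _ = refl
  ... | no _ with inStar K M
  ...   | yes _ = begin
    ∑ (λ T → (ne T * ends T) * ⟦ M ⊆? T ⟧) Ts
      ≤⟨ ∑-mono Ts (λ {T} _ → drop T) ⟩
    ∑ (λ T → ⟦ M₁ ⊆? T ⟧ * ⟦ M ⊆? T ⟧ + ⟦ M₂ ⊆? T ⟧ * ⟦ M ⊆? T ⟧) Ts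
      ≡⟨ ∑-+ _ _ Ts ⟩
    ∑ (λ T → ⟦ M₁ ⊆? T ⟧ * ⟦ M ⊆? T ⟧) Ts + ∑ (λ T → ⟦ M₂ ⊆? T ⟧ * ⟦ M ⊆? T ⟧) Ts
      ≤⟨ +-mono-≤ (∑-pair≤1 l (here refl) (there (there M∈)) (head≢ l (there M∈)))
           (∑-pair≤1 l (there (here refl)) (there (there M∈)) (head≢ (layers-tail l) M∈)) ⟩
    2 ∎
    where
    open ≤-Reasoning
    drop : ∀ T → (ne T * ends T) * ⟦ M ⊆? T ⟧ ≤ ⟦ M₁ ⊆? T ⟧ * ⟦ M ⊆? T ⟧ + ⟦ M₂ ⊆? T ⟧ * ⟦ M ⊆? T ⟧
    drop T = begin
      (ne T * ends T) * ⟦ M ⊆? T ⟧ ≤⟨ *-monoˡ-≤ ⟦ M ⊆? T ⟧ (*-monoˡ-≤ (ends T) (⟦⟧≤1 (¬? (T ≟ˢ T₀)))) ⟩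
      (1 * ends T) * ⟦ M ⊆? T ⟧    ≡⟨ cong (_* ⟦ M ⊆? T ⟧) (*-identityˡ (ends T)) ⟩
      ends T * ⟦ M ⊆? T ⟧          ≡⟨ *-distribʳ-+ ⟦ M ⊆? T ⟧ ⟦ M₁ ⊆? T ⟧ ⟦ M₂ ⊆? T ⟧ ⟩
      ⟦ M₁ ⊆? T ⟧ * ⟦ M ⊆? T ⟧ + ⟦ M₂ ⊆? T ⟧ * ⟦ M ⊆? T ⟧ ∎
  ...   | no K⊈M with y , y∈K , y∉M ← ⊈⇒∃ K⊈M = begin
    ∑ (λ T → (ne T * ends T) * ⟦ M ⊆? T ⟧) Ts
      ≤⟨ ∑-mono Ts one ⟩
    ∑ (λ T → ⟦ inStar K T ×-dec M ⊆? T ⟧) Ts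
      ≤⟨ ∑-at-most-one (λ T → inStar K T ×-dec M ⊆? T) (Ts-unique l)
           (λ T∈ T′∈ (K⊆T , M⊆T) (K⊆T′ , M⊆T′) → ⋖-join (cover l (there (there M∈)) T∈ M⊆T)
             (cover l (there (there M∈)) T′∈ M⊆T′) (K⊆T y∈K) (K⊆T′ y∈K) y∉M) ⟩
    1 ∎
    where
    open ≤-Reasoning
    one : ∀ {T} → T ∈ₗ Ts → (ne T * ends T) * ⟦ M ⊆? T ⟧ ≤ ⟦ inStar K T ×-dec M ⊆? T ⟧
    one {T} T∈ with T ≟ˢ T₀ | M₁ ⊆? T | M₂ ⊆? T | M ⊆? T
    ... | yes _ | _ | _ | _ = z≤n
    ... | no ≢ | yes p | yes q | _ =
      contradiction (⋖-two (cover₁ T∈ p) (cover₂ T∈ q) (cover₁ T₀∈ M₁⊆) (cover₂ T₀∈ M₂⊆) M₁≢M₂) ≢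
    ... | no _ | no _ | no _ | _ = z≤n
    ... | no _ | yes p | no _ | no _ = z≤n
    ... | no _ | no _ | yes p | no _ = z≤n
    ... | no _ | yes p | no _ | yes q = 1≤⟦⟧-× (inStar K T) _ (λ z∈ → p (K⊆₁ z∈)) (λ {z} → q {z})
    ... | no _ | no _ | yes p | yes q = 1≤⟦⟧-× (inStar K T) _ (λ z∈ → p (K⊆₂ z∈)) (λ {z} → q {z})

  -- The pair itself costs 1 on `T₀`. Each remaining M costs at most 1, or 2 if it lies in the star:
  -- all lines through `M₁` or `M₂` contain K, and outside the star M lies on at most one line
  -- containing K.
  V-peel : V (M₁ ∷ M₂ ∷ L) Ts ≤ V L Ts + (1 + (length L + star K L))
  V-peel = begin
    V (M₁ ∷ M₂ ∷ L) Ts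
      ≤⟨ ∑-mono Ts pointwise ⟩
    ∑ (λ T → weight (L # T) + (e T * suc (L # T) + (ne T * ends T) * L # T)) Ts
      ≡⟨ ∑-+ _ _ Ts ∙ cong (V L Ts +_) (∑-+ _ _ Ts) ⟩
    V L Ts + (∑ (λ T → e T * suc (L # T)) Ts + ∑ (λ T → (ne T * ends T) * L # T) Ts)
      ≤⟨ +-monoʳ-≤ (V L Ts) (+-mono-≤
           (∑-only (_≟ˢ T₀) (λ T → suc (L # T)) (Ts-unique l) (λ _ _ a b → a ∙ sym b) (λ { refl → ≤-refl }))
           (≤-reflexive (∑-weighted (λ T → ne T * ends T) L Ts))) ⟩
    V L Ts + (suc (L # T₀) + ∑ (λ M → ∑ (λ T → (ne T * ends T) * ⟦ M ⊆? T ⟧) Ts) L)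
      ≡⟨ cong (λ z → V L Ts + suc z) (∑-+ (λ M → ⟦ M ⊆? T₀ ⟧) _ L) ⟨
    V L Ts + suc (∑ (λ M → ⟦ M ⊆? T₀ ⟧ + ∑ (λ T → (ne T * ends T) * ⟦ M ⊆? T ⟧) Ts) L)
      ≤⟨ +-monoʳ-≤ (V L Ts) (s≤s (∑-mono L inner)) ⟩
    V L Ts + suc (∑ (λ M → 1 + ⟦ inStar K M ⟧) L)
      ≡⟨ cong (λ z → V L Ts + suc z) (∑-+ (λ _ → 1) (⟦_⟧ ∘ inStar K) L ∙ cong (_+ star K L) (sym (length≡∑ L))) ⟩
    V L Ts + (1 + (length L + star K L)) ∎
    where open ≤-Reasoning

-- Bounds on `V` in terms of star sizes

Bounded : ℕ → List FinSet → List FinSet → Set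
Bounded m L Ts = ∀ {M₁ M₂ T} → M₁ ∈ₗ L → M₂ ∈ₗ L → T ∈ₗ Ts → M₁ ⋖ T → M₂ ⋖ T → M₁ ≢ M₂ →
  star (meet M₁ M₂) L ≤ m

meet⊆₁ : ∀ M₁ M₂ → meet M₁ M₂ ⊆ₗ elements M₁
meet⊆₁ M₁ M₂ z∈ = proj₁ (∈-filter⁻ (_∈? elements M₂) z∈)

meet⊆₂ : ∀ M₁ M₂ → meet M₁ M₂ ⊆ₗ elements M₂
meet⊆₂ M₁ M₂ z∈ = proj₂ (∈-filter⁻ (_∈? elements M₂) {xs = elements M₁} z∈)

meet-unique : ∀ M₁ M₂ → Unique (meet M₁ M₂)
meet-unique M₁ M₂ = unique-filter (_∈? elements M₂) (unique M₁)

star-∷∷ : ∀ M₁ M₂ L → star (meet M₁ M₂) (M₁ ∷ M₂ ∷ L) ≡ 2 + star (meet M₁ M₂) L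
star-∷∷ M₁ M₂ L = cong₂ (λ a b → a + (b + star (meet M₁ M₂) L))
  (⟦⟧-yes (inStar (meet M₁ M₂) M₁) (meet⊆₁ M₁ M₂))
  (⟦⟧-yes (inStar (meet M₁ M₂) M₂) (meet⊆₂ M₁ M₂))

bounded-∷∷ : ∀ {m M₁ M₂ L Ts} → Bounded m (M₁ ∷ M₂ ∷ L) Ts → Bounded m L Ts
bounded-∷∷ {M₁ = N₁} {N₂} {L} bd {M₁} {M₂} M₁∈ M₂∈ T∈ M₁⋖T M₂⋖T M₁≢M₂ =
  ≤-trans (≤-trans (m≤n+m (star K L) ⟦ inStar K N₂ ⟧) (m≤n+m _ ⟦ inStar K N₁ ⟧))
    (bd (there (there M₁∈)) (there (there M₂∈)) T∈ M₁⋖T M₂⋖T M₁≢M₂)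
  where K = meet M₁ M₂

bounded-↭ : ∀ {m L L′ Ts} → L ↭ L′ → Bounded m L Ts → Bounded m L′ Ts
bounded-↭ p bd M∈ M′∈ T∈ M⋖T M′⋖T M≢M′ =
  ≤-trans (≤-reflexive (∑-↭ _ (↭-sym p)))
    (bd (∈-resp-↭ (↭-sym p) M∈) (∈-resp-↭ (↭-sym p) M′∈) T∈ M⋖T M′⋖T M≢M′)

bounded-filter : ∀ {m L Ts} {P : FinSet → Set} (P? : Decidable P) → Bounded m L Ts → Bounded m (filter P? L) Ts
bounded-filter {L = L} P? bd M∈ M′∈ T∈ M⋖T M′⋖T M≢M′ =
  ≤-trans (≤-trans (m≤m+n _ _) (≤-reflexive (sym (∑-split P? _ L))))
    (bd (proj₁ (∈-filter⁻ P? M∈)) (proj₁ (∈-filter⁻ P? M′∈)) T∈ M⋖T M′⋖T M≢M′)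

-- L is rearranged with two points of a common line in front, the shape that `EdgePeel` takes.
record Collinear (L Ts : List FinSet) : Set where
  field
    {M₁ M₂ T₀} : FinSet
    {rest}     : List FinSet
    T₀∈        : T₀ ∈ₗ Ts
    arrange    : L ↭ M₁ ∷ M₂ ∷ rest
    M₁⊆        : M₁ ⊆ T₀
    M₂⊆        : M₂ ⊆ T₀

collinear? : ∀ {s L Ts} → Layers s L Ts → Collinear L Ts ⊎ V L Ts ≡ 0
collinear? {L = L} {Ts} l with any? (λ T → 2 ≤? L # T) Ts
... | yes ∃T with T₀ , T₀∈ , 2≤ ← find ∃T with M₁ , M₂ , rest , p , M₁⊆ , M₂⊆ ← pick₂ (_⊆? T₀) L 2≤ =
  inj₁ record { T₀∈ = T₀∈ ; arrange = p ; M₁⊆ = M₁⊆ ; M₂⊆ = M₂⊆ }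
... | no ∄T = inj₂ (∑-none Ts λ T∈ → weight-small (λ 2≤ → ∄T (lose T∈ 2≤)))

-- The bound solves the recursion in which removing a collinear pair costs at most |L| + m - 3. It
-- ends when no two points are collinear: then `V` vanishes and `2 ≤ m` suffices. The number k is
-- the termination measure.
V-edge-peel : ∀ k {s m} L {Ts} → length L ≤ k → Layers s L Ts → 2 ≤ m → Bounded m L Ts →
  4 * V L Ts + 4 * length L ≤ length L * length L + 2 * m * length L
V-edge-peel k {m = m} L {Ts} len l 2≤m bd with collinear? l
... | inj₂ V≡0 rewrite V≡0 = ≤-trans (*-monoˡ-≤ (length L) (*-monoʳ-≤ 2 2≤m)) (m≤n+m _ _)
... | inj₁ record { M₁ = M₁ ; M₂ = M₂ ; rest = R ; T₀∈ = T₀∈ ; arrange = p ; M₁⊆ = M₁⊆ ; M₂⊆ = M₂⊆ }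
  with k | ≤-trans (≤-reflexive (sym (↭-length p))) len
... | suc (suc k) | s≤s (s≤s len′) = begin
  4 * V L Ts + 4 * length L
    ≡⟨ cong₂ (λ a b → 4 * a + 4 * b) (∑-cong Ts (λ _ → cong weight (∑-↭ _ p))) (↭-length p) ⟩
  4 * V (M₁ ∷ M₂ ∷ R) Ts + 4 * (2 + ℓ)
    ≤⟨ +-monoˡ-≤ _ (*-monoʳ-≤ 4 (EdgePeel.V-peel l′ T₀∈ M₁⊆ M₂⊆)) ⟩
  4 * (V R Ts + (1 + (ℓ + star K R))) + 4 * (2 + ℓ)
    ≡⟨ lemma (V R Ts) ℓ (star K R) ⟩
  4 * V R Ts + 4 * ℓ + 4 * (2 + star K R) + (4 * ℓ + 4)
    ≤⟨ +-monoˡ-≤ (4 * ℓ + 4) (+-mono-≤ (V-edge-peel k R len′ (layers-tail (layers-tail l′)) 2≤m (bounded-∷∷ bd′))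
        (*-monoʳ-≤ 4 star≤)) ⟩
  ℓ * ℓ + 2 * m * ℓ + 4 * m + (4 * ℓ + 4)
    ≡⟨ lemma₂ ℓ m ⟩
  (2 + ℓ) * (2 + ℓ) + 2 * m * (2 + ℓ)
    ≡⟨ cong (λ z → z * z + 2 * m * z) (↭-length p) ⟨
  length L * length L + 2 * m * length L ∎
  where
  open ≤-Reasoning

  ℓ = length R
  K = meet M₁ M₂
  l′ = layers-↭ l p
  bd′ : Bounded m (M₁ ∷ M₂ ∷ R) Ts
  bd′ = bounded-↭ {L = L} p bd
  star≤ : 2 + star K R ≤ m
  star≤ = ≤-trans (≤-reflexive (sym (star-∷∷ M₁ M₂ R))) (bd′ (here refl) (there (here refl)) T₀∈
    (cover l′ (here refl) T₀∈ M₁⊆) (cover l′ (there (here refl)) T₀∈ M₂⊆) (head≢ l′ (here refl)))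
  lemma : ∀ v ℓ s → 4 * (v + (1 + (ℓ + s))) + 4 * (2 + ℓ) ≡ 4 * v + 4 * ℓ + 4 * (2 + s) + (4 * ℓ + 4)
  lemma = solve-∀
  lemma₂ : ∀ ℓ m → ℓ * ℓ + 2 * m * ℓ + 4 * m + (4 * ℓ + 4) ≡ (2 + ℓ) * (2 + ℓ) + 2 * m * (2 + ℓ)
  lemma₂ = solve-∀

record BigStar (m : ℕ) (L Ts : List FinSet) : Set where
  field
    {M₁ M₂ T₀} : FinSet
    M₁∈        : M₁ ∈ₗ L
    M₂∈        : M₂ ∈ₗ L
    T₀∈        : T₀ ∈ₗ Ts
    M₁⊆        : M₁ ⊆ T₀
    M₂⊆        : M₂ ⊆ T₀
    M₁≢M₂      : M₁ ≢ M₂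
    big        : m < star (meet M₁ M₂) L

bigStar? : ∀ m L Ts → BigStar m L Ts ⊎ Bounded m L Ts
bigStar? m L Ts with any? (λ T → any? (λ M₁ → any? (λ M₂ →
    M₁ ⊆? T ×-dec M₂ ⊆? T ×-dec ¬? (M₁ ≟ˢ M₂) ×-dec (m <? star (meet M₁ M₂) L)) L) L) Ts
... | yes ∃T with T₀ , T₀∈ , ∃M₁ ← find ∃T with M₁ , M₁∈ , ∃M₂ ← find ∃M₁
             with M₂ , M₂∈ , M₁⊆ , M₂⊆ , ≢ , big ← find ∃M₂ =
  inj₁ record { M₁∈ = M₁∈ ; M₂∈ = M₂∈ ; T₀∈ = T₀∈ ; M₁⊆ = M₁⊆ ; M₂⊆ = M₂⊆ ; M₁≢M₂ = ≢ ; big = big }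
... | no ∄T = inj₂ λ M₁∈ M₂∈ T∈ M₁⋖T M₂⋖T ≢ → ≮⇒≥ λ big →
  ∄T (lose T∈ (lose M₁∈ (lose M₂∈ (_⋖_.below M₁⋖T , _⋖_.below M₂⋖T , ≢ , big))))

-- Induction on the star bound m = 2 + k. For m = 2 edge peeling alone gives the claim. For larger
-- m, if no star reaches m, the case m - 1 applies; otherwise a star with exactly m members is
-- peeled off and edge peeling is applied to the rest.
V-quadratic : ∀ k {s} L {Ts} → Layers s L Ts → Bounded (2 + k) L Ts →
  4 * V L Ts + 2 * (2 + k) ≤ length L * length L + (2 + k) * (2 + k)
V-quadratic zero L {Ts} l bd = +-monoˡ-≤ 4 (+-cancelʳ-≤ (4 * length L) _ _
  (V-edge-peel (length L) L ≤-refl l ≤-refl bd))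
V-quadratic (suc k) {s} L {Ts} l bd with bigStar? (2 + k) L Ts
... | inj₂ bd′ = begin
  4 * V L Ts + 2 * (3 + k)                     ≡⟨ lemma (V L Ts) k ⟩
  4 * V L Ts + 2 * (2 + k) + 2                 ≤⟨ +-mono-≤ (V-quadratic k L l bd′) (m≤m+n 2 (3 + 2 * k)) ⟩
  ℓ * ℓ + (2 + k) * (2 + k) + (2 + (3 + 2 * k)) ≡⟨ lemma₂ ℓ k ⟩
  ℓ * ℓ + (3 + k) * (3 + k)                    ∎
  where
  open ≤-Reasoning
  ℓ = length L
  lemma : ∀ v k → 4 * v + 2 * (3 + k) ≡ 4 * v + 2 * (2 + k) + 2
  lemma = solve-∀
  lemma₂ : ∀ ℓ k → ℓ * ℓ + (2 + k) * (2 + k) + (2 + (3 + 2 * k)) ≡ ℓ * ℓ + (3 + k) * (3 + k)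
  lemma₂ = solve-∀
... | inj₁ record { M₁ = M₁ ; M₂ = M₂ ; M₁∈ = M₁∈ ; M₂∈ = M₂∈ ; T₀∈ = T₀∈ ; M₁⊆ = M₁⊆ ; M₂⊆ = M₂⊆ ; M₁≢M₂ = ≢ ; big = big } = begin
  4 * V L Ts + 2 * m
    ≤⟨ +-monoˡ-≤ (2 * m) (*-monoʳ-≤ 4 V-peel) ⟩
  4 * (V J Ts + (tri (length S) + length J)) + 2 * m
    ≡⟨ cong (λ z → 4 * (V J Ts + (tri z + length J)) + 2 * m) S≡m ⟩
  4 * (V J Ts + (tri m + length J)) + 2 * m
    ≡⟨ lemma (V J Ts) (tri m) (length J) m ⟩
  4 * V J Ts + 4 * length J + 2 * (tri m + tri m + m)
    ≤⟨ +-mono-≤ (V-edge-peel (length J) J ≤-refl lJ (s≤s (s≤s z≤n)) (bounded-filter {L = L} (¬? ∘ inStar K) bd))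
         (≤-reflexive (cong (2 *_) (double-tri m))) ⟩
  length J * length J + 2 * m * length J + 2 * (m * m)
    ≡⟨ lemma₂ (length J) m ⟩
  (m + length J) * (m + length J) + m * m
    ≡⟨ cong (λ z → z * z + m * m) (lengths ∙ cong (_+ length J) S≡m) ⟨
  length L * length L + m * m ∎
  where
  open ≤-Reasoning
  m = 3 + k
  M₁⋖ = cover l M₁∈ T₀∈ M₁⊆
  M₂⋖ = cover l M₂∈ T₀∈ M₂⊆
  K = meet M₁ M₂
  open StarPeel l (meet-unique M₁ M₂) (≤-trans (≤-reflexive (sym (L-size l M₁∈))) (length-meet M₁⋖ M₂⋖))
  -- The star has more than 2 + k members, and the hypothesis caps it at 3 + k.
  S≡m : length S ≡ m
  S≡m = length-filter≡∑ (inStar K) L ∙ ≤-antisym (bd M₁∈ M₂∈ T₀∈ M₁⋖ M₂⋖ ≢) big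
  lemma : ∀ v t j m → 4 * (v + (t + j)) + 2 * m ≡ 4 * v + 4 * j + 2 * (t + t + m)
  lemma = solve-∀
  lemma₂ : ∀ j m → j * j + 2 * m * j + 2 * (m * m) ≡ (m + j) * (m + j) + m * m
  lemma₂ = solve-∀

2ab≤a²+b² : ∀ a b → 2 * (a * b) ≤ a * a + b * b
2ab≤a²+b² a b with ≤-total a b
... | inj₁ a≤b with d , refl ← m≤n⇒∃[o]m+o≡n a≤b = ≤-trans (m≤m+n _ (d * d)) (≤-reflexive (lemma a d))
  where
  lemma : ∀ a d → 2 * (a * (a + d)) + d * d ≡ a * a + (a + d) * (a + d)
  lemma = solve-∀
... | inj₂ b≤a with d , refl ← m≤n⇒∃[o]m+o≡n b≤a = ≤-trans (m≤m+n _ (d * d)) (≤-reflexive (lemma b d))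
  where
  lemma : ∀ b d → 2 * ((b + d) * b) + d * d ≡ (b + d) * (b + d) + b * b
  lemma = solve-∀

-- If v were at least 2 + tri c + 2 tri j, then 2c(j + 1) ≤ c² + (j + 1)² would turn the hypothesis
-- into (j - 2)² + 3 ≤ 0. The computation carries all negative terms to the other side.
quadratic⇒tri : ∀ c j v → 4 * v + 2 * j ≤ (c + j) * (c + j) + j * j → v ≤ suc (tri c + (tri j + tri j))
quadratic⇒tri c j v h with v ≤? suc (tri c + (tri j + tri j))
... | yes p = p
... | no ¬p = contradiction bad (<⇒≱ (≤-refl {suc big}))
  where
  open ≤-Reasoning
  big : ℕ
  big = c * c + 4 * (j * j) + (c * c) + 4 * j
  lemma₁ : ∀ c j → suc (c * c + 4 * (j * j) + (c * c) + 4 * j) + 7 ≡ 2 * (c * c) + 4 * (j * j) + 8 + 4 * j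
  lemma₁ = solve-∀
  lemma₂ : ∀ c j x y → 2 * (x + x + c) + 4 * (y + y + j) + 8 + 4 * j ≡ 4 * (2 + (x + (y + y))) + 2 * j + (2 * c + 6 * j)
  lemma₂ = solve-∀
  lemma₃ : ∀ c j → (c + j) * (c + j) + j * j + (2 * c + 6 * j) ≡ 2 * (c * suc j) + (c * c + 2 * (j * j) + 6 * j)
  lemma₃ = solve-∀
  lemma₄ : ∀ c j → c * c + suc j * suc j + (c * c + 2 * (j * j) + 6 * j) ≡ c * c + c * c + 3 * (j * j) + 1 + 4 * j + 2 * (2 * j)
  lemma₄ = solve-∀
  lemma₅ : ∀ c j → c * c + c * c + 3 * (j * j) + 1 + 4 * j + (2 * 2 + j * j) + 2 ≡ c * c + 4 * (j * j) + (c * c) + 4 * j + 7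
  lemma₅ = solve-∀
  bad : suc big ≤ big
  bad = +-cancelʳ-≤ 7 _ _ (begin
    suc big + 7
      ≡⟨ lemma₁ c j ⟩
    2 * (c * c) + 4 * (j * j) + 8 + 4 * j
      ≡⟨ cong₂ (λ x y → 2 * x + 4 * y + 8 + 4 * j) (double-tri c) (double-tri j) ⟨
    2 * (tri c + tri c + c) + 4 * (tri j + tri j + j) + 8 + 4 * j
      ≡⟨ lemma₂ c j (tri c) (tri j) ⟩
    4 * (2 + (tri c + (tri j + tri j))) + 2 * j + (2 * c + 6 * j)
      ≤⟨ +-monoˡ-≤ _ (+-monoˡ-≤ (2 * j) (*-monoʳ-≤ 4 (≰⇒> ¬p))) ⟩
    4 * v + 2 * j + (2 * c + 6 * j)
      ≤⟨ +-monoˡ-≤ (2 * c + 6 * j) h ⟩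
    (c + j) * (c + j) + j * j + (2 * c + 6 * j)
      ≡⟨ lemma₃ c j ⟩
    2 * (c * suc j) + (c * c + 2 * (j * j) + 6 * j)
      ≤⟨ +-monoˡ-≤ _ (2ab≤a²+b² c (suc j)) ⟩
    c * c + suc j * suc j + (c * c + 2 * (j * j) + 6 * j)
      ≡⟨ lemma₄ c j ⟩
    c * c + c * c + 3 * (j * j) + 1 + 4 * j + 2 * (2 * j)
      ≤⟨ +-monoʳ-≤ (c * c + c * c + 3 * (j * j) + 1 + 4 * j) (2ab≤a²+b² 2 j) ⟩
    c * c + c * c + 3 * (j * j) + 1 + 4 * j + (2 * 2 + j * j)
      ≤⟨ m≤m+n _ 2 ⟩
    c * c + c * c + 3 * (j * j) + 1 + 4 * j + (2 * 2 + j * j) + 2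
      ≡⟨ lemma₅ c j ⟩
    big + 7 ∎)

-- Parity absorbs the odd unit, so a bound on `V` may exceed its target by 1.
halve : ∀ {y k} → y + y ≤ suc (k + k) → y ≤ k
halve {y} {k} h with y ≤? k
... | yes p = p
... | no ¬p = contradiction (+-mono-≤ (≰⇒> ¬p) (≰⇒> ¬p)) (<⇒≱ (s≤s (≤-trans h (≤-reflexive (sym (+-suc k k))))))

j≤1+tri : ∀ j → j ≤ suc (tri j)
j≤1+tri zero    = z≤n
j≤1+tri (suc j) = s≤s (m≤m+n j _)

-- The bound on the number y of lines

module _ {s L Ts} (l : Layers s L Ts) {b y} (y≤s₂ : y ≤ s₂ L Ts) (y≤b+s₃ : y ≤ b + s₃ L Ts) where
  open ≤-Reasoning

  -- Two collinear points belong to the star of their own meet, so that star has at least two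
  -- members.
  V≡0 : ∀ {j} → j ≤ 1 → Bounded j L Ts → V L Ts ≡ 0
  V≡0 j≤1 bd with collinear? l
  ... | inj₂ eq = eq
  ... | inj₁ record { M₁ = M₁ ; M₂ = M₂ ; rest = R ; T₀∈ = T₀∈ ; arrange = p ; M₁⊆ = M₁⊆ ; M₂⊆ = M₂⊆ } =
    contradiction (begin
      2                                       ≤⟨ m≤m+n 2 _ ⟩
      2 + star (meet M₁ M₂) R                 ≡⟨ star-∷∷ M₁ M₂ R ⟨
      star (meet M₁ M₂) (M₁ ∷ M₂ ∷ R)         ≤⟨ bounded-↭ {L = L} p bd (here refl) (there (here refl)) T₀∈
        (cover l′ (here refl) T₀∈ M₁⊆) (cover l′ (there (here refl)) T₀∈ M₂⊆) (head≢ l′ (here refl)) ⟩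
      _                                       ≤⟨ j≤1 ⟩
      1                                       ∎) (<⇒≱ ≤-refl)
    where l′ = layers-↭ l p

  2y≤b+V : y + y ≤ b + V L Ts
  2y≤b+V = begin
    y + y                         ≤⟨ +-mono-≤ y≤s₂ y≤b+s₃ ⟩
    s₂ L Ts + (b + s₃ L Ts)       ≡⟨ lemma (s₂ L Ts) b (s₃ L Ts) ⟩
    b + (s₂ L Ts + s₃ L Ts)       ≡⟨ cong (b +_) (V≡ L Ts) ⟨
    b + V L Ts                    ∎
    where
    lemma : ∀ x b z → x + (b + z) ≡ b + (x + z)
    lemma = solve-∀

  -- In the bound on 2y both b and `tri c` are raised to their maximum, after which everything but
  -- the unit is doubled.
  from-V : ∀ c j → V L Ts ≤ suc (tri c + (tri j + tri j)) → y ≤ b ⊔ tri c + tri j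
  from-V c j V≤ = halve (begin
    y + y                                           ≤⟨ 2y≤b+V ⟩
    b + V L Ts                                      ≤⟨ +-mono-≤ (m≤m⊔n b (tri c)) V≤ ⟩
    b ⊔ tri c + suc (tri c + (tri j + tri j))       ≤⟨ +-monoʳ-≤ (b ⊔ tri c) (s≤s (+-monoˡ-≤ _ (m≤n⊔m b (tri c)))) ⟩
    b ⊔ tri c + suc (b ⊔ tri c + (tri j + tri j))   ≡⟨ lemma (b ⊔ tri c) (tri j) ⟩
    suc (b ⊔ tri c + tri j + (b ⊔ tri c + tri j))   ∎)
    where
    lemma : ∀ x t → x + suc (x + (t + t)) ≡ suc (x + t + (x + t))
    lemma = solve-∀

  from-bounded : ∀ c j → length L ≡ c + j → Bounded j L Ts → y ≤ b ⊔ tri c + tri j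
  from-bounded c (suc (suc k)) ℓ≡ bd = from-V c (2 + k) (quadratic⇒tri c (2 + k) _
    (≤-trans (V-quadratic k L l bd) (≤-reflexive (cong (λ z → z * z + (2 + k) * (2 + k)) ℓ≡))))
  from-bounded c zero       ℓ≡ bd = from-V c 0 (≤-trans (≤-reflexive (V≡0 z≤n bd)) z≤n)
  from-bounded c (suc zero) ℓ≡ bd = from-V c 1 (≤-trans (≤-reflexive (V≡0 ≤-refl bd)) z≤n)

  -- Let m > j be the size of the star and n that of the rest. If m ≤ c, peeling gives V ≤ tri m +
  -- tri (n + 1); since m and n + 1 have the same sum as c and j + 1, `tri-majorize` applies. If m >
  -- c, then n < j, and y ≤ b + s₃ suffices, as peeling the star costs s₃ at most n.
  from-star : ∀ c j → length L ≡ c + j → BigStar j L Ts → y ≤ b ⊔ tri c + tri j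
  from-star c j ℓ≡ record { M₁ = M₁ ; M₂ = M₂ ; M₁∈ = M₁∈ ; M₂∈ = M₂∈ ; T₀∈ = T₀∈ ; M₁⊆ = M₁⊆ ; M₂⊆ = M₂⊆ ; big = big } =
    by-size
    where
    open StarPeel l (meet-unique M₁ M₂) (≤-trans (≤-reflexive (sym (L-size l M₁∈)))
      (length-meet (cover l M₁∈ T₀∈ M₁⊆) (cover l M₂∈ T₀∈ M₂⊆)))
    m n : ℕ
    m = length S
    n = length J
    j<m : j < m
    j<m = ≤-trans big (≤-reflexive (sym (length-filter≡∑ (inStar (meet M₁ M₂)) L)))
    m+n≡ : m + n ≡ c + j
    m+n≡ = sym lengths ∙ ℓ≡
    n<c : n < c
    n<c = +-cancelʳ-≤ j (suc n) c (begin
      suc n + j ≡⟨ +-suc n j ⟨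
      n + suc j ≤⟨ +-monoʳ-≤ n j<m ⟩
      n + m     ≡⟨ +-comm n m ∙ m+n≡ ⟩
      c + j     ∎)
    by-size : y ≤ b ⊔ tri c + tri j
    by-size with m ≤? c
    ... | yes m≤c = from-V c j (begin
      V L Ts                          ≤⟨ V-peel ⟩
      V J Ts + (tri m + n)            ≤⟨ +-monoˡ-≤ (tri m + n) (V≤tri lJ) ⟩
      tri n + (tri m + n)             ≡⟨ lemma (tri n) (tri m) n ⟩
      tri m + tri (suc n)             ≤⟨ tri-majorize m≤c n<c (+-suc m n ∙ (cong suc m+n≡ ∙ sym (+-suc c j))) ⟩
      tri c + (j + tri j)             ≤⟨ +-monoʳ-≤ (tri c) (+-monoˡ-≤ (tri j) (j≤1+tri j)) ⟩
      tri c + suc (tri j + tri j)     ≡⟨ +-suc (tri c) _ ⟩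
      suc (tri c + (tri j + tri j))   ∎)
      where
      lemma : ∀ x y n → x + (y + n) ≡ y + (n + x)
      lemma = solve-∀
    ... | no m≰c = begin
      y                       ≤⟨ y≤b+s₃ ⟩
      b + s₃ L Ts             ≤⟨ +-monoʳ-≤ b s₃-peel ⟩
      b + (s₃ J Ts + n)       ≤⟨ +-monoʳ-≤ b (+-monoˡ-≤ n (s₃≤tri lJ)) ⟩
      b + (tri n + n)         ≡⟨ cong (b +_) (+-comm (tri n) n) ⟩
      b + tri (suc n)         ≤⟨ +-mono-≤ (m≤m⊔n b (tri c)) (tri-mono n<j) ⟩
      b ⊔ tri c + tri j       ∎
      where
      n<j : n < j
      n<j = +-cancelˡ-≤ c (suc n) j (begin
        c + suc n ≡⟨ +-suc c n ⟩
        suc c + n ≤⟨ +-monoˡ-≤ n (≰⇒> m≰c) ⟩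
        m + n     ≡⟨ m+n≡ ⟩
        c + j     ∎)

  lines-bound : ∀ c j → length L ≡ c + j → y ≤ b ⊔ tri c + tri j
  lines-bound c j ℓ≡ with bigStar? j L Ts
  ... | inj₁ bs = from-star c j ℓ≡ bs
  ... | inj₂ bd = from-bounded c j ℓ≡ bd

-- The bound for k = 3

-- The absorption identity, which compares `tet` with multiples of `tri`.
tet-tri : ∀ k → 3 * tet (2 + k) ≡ k * tri (2 + k)
tet-tri zero    = refl
tet-tri (suc k) = lemma (tri (2 + k)) (tet (2 + k)) ∙ (cong (3 * tri (2 + k) +_) (tet-tri k) ∙ (lemma₂ k (tri (2 + k)) ∙
  (cong (λ z → suc k * tri (2 + k) + z) (two (tri (1 + k)) k (double-tri (1 + k))) ∙ lemma₃ k (tri (2 + k)))))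
  where
  lemma : ∀ t u → 3 * (t + u) ≡ 3 * t + 3 * u
  lemma = solve-∀
  lemma₂ : ∀ k t → 3 * t + k * t ≡ suc k * t + (t + t)
  lemma₂ = solve-∀
  lemma₃ : ∀ k t → suc k * t + suc k * (2 + k) ≡ suc k * (2 + k + t)
  lemma₃ = solve-∀
  two : ∀ t k → t + t + suc k ≡ suc k * suc k → suc k + t + (suc k + t) ≡ suc k * (2 + k)
  two t k eq = l₁ t k ∙ (cong (_+ suc k) eq ∙ l₂ k)
    where
    l₁ : ∀ t k → suc k + t + (suc k + t) ≡ t + t + suc k + suc k
    l₁ = solve-∀
    l₂ : ∀ k → suc k * suc k + suc k ≡ suc k * (2 + k)
    l₂ = solve-∀

third : ∀ {a k} → 3 * a ≤ 3 * k + 2 → a ≤ k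
third {a} {k} h with a ≤? k
... | yes p = p
... | no ¬p = contradiction (begin
  3 * k + 3     ≡⟨ lemma k ⟩
  3 * suc k     ≤⟨ *-monoʳ-≤ 3 (≰⇒> ¬p) ⟩
  3 * a         ≤⟨ h ⟩
  3 * k + 2     ∎) (<⇒≱ (+-monoʳ-< (3 * k) ≤-refl))
  where
  open ≤-Reasoning
  lemma : ∀ k → 3 * k + 3 ≡ 3 * suc k
  lemma = solve-∀

-- `6 ≤ b` puts b in row 4 or later, where 3 tet c ≥ 2 tri c by `tet-tri`. The partial row leaves an
-- excess of at most 2, which `third` absorbs.
kk-sparse₂ : ∀ a b → 6 ≤ b → 3 * a ≤ 2 * b → a ≤ kk b
kk-sparse₂ a b 6≤b h with row b
... | c , e , e<c , refl with k , refl ← m≤n⇒∃[o]m+o≡n {4} (tri-cancel {4} e<c 6≤b) = third (begin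
  3 * a                                  ≤⟨ h ⟩
  2 * (tri (4 + k) + e)                  ≡⟨ *-distribˡ-+ 2 (tri (4 + k)) e ⟩
  2 * tri (4 + k) + 2 * e                ≤⟨ +-mono-≤ (*-monoˡ-≤ (tri (4 + k)) (m≤m+n 2 k)) (*-monoʳ-≤ 2 (j≤1+tri e)) ⟩
  (2 + k) * tri (4 + k) + 2 * suc (tri e) ≤⟨ +-monoʳ-≤ ((2 + k) * tri (4 + k)) (≤-trans (m≤m+n _ (tri e)) (≤-reflexive (lemma (tri e)))) ⟩
  (2 + k) * tri (4 + k) + (3 * tri e + 2) ≡⟨ cong (_+ (3 * tri e + 2)) (tet-tri (2 + k)) ⟨
  3 * tet (4 + k) + (3 * tri e + 2)      ≡⟨ lemma₂ (tet (4 + k)) (tri e) ⟩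
  3 * (tet (4 + k) + tri e) + 2          ≡⟨ cong (λ z → 3 * z + 2) (kk-row (4 + k) e (<⇒≤ e<c)) ⟨
  3 * kk (tri (4 + k) + e) + 2           ∎)
  where
  open ≤-Reasoning
  lemma : ∀ t → 2 * suc t + t ≡ 3 * t + 2
  lemma = solve-∀
  lemma₂ : ∀ x t → 3 * x + (3 * t + 2) ≡ 3 * (x + t) + 2
  lemma₂ = solve-∀

-- With b ≤ 5 only a ≤ 1 is possible, and `kk 3` is 1.
kk-sparse₁ : ∀ a b → b ≤ 5 → 3 * a ≤ b → a ≤ kk b
kk-sparse₁ zero          b b≤5 h = z≤n
kk-sparse₁ (suc zero)    b b≤5 h = kk-mono {3} h
kk-sparse₁ (suc (suc a)) b b≤5 h = contradiction (≤-trans (≤-trans (*-monoʳ-≤ 3 (m≤m+n 2 a)) h) b≤5) λ where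
  (s≤s (s≤s (s≤s (s≤s (s≤s ())))))

-- Splitting both layers at a point x, and the induction

has : ∀ x → Decidable (λ M → x ∈ₗ elements M)
has x M = x ∈? elements M

1≤atLeast₂ : ∀ {n} → 2 ≤ n → 1 ≤ atLeast₂ n
1≤atLeast₂ (s≤s (s≤s _)) = ≤-refl

atLeast₃≡ : ∀ n → atLeast₃ n ≡ ⟦ 3 ≤? n ⟧
atLeast₃≡ zero                = refl
atLeast₃≡ (suc zero)          = refl
atLeast₃≡ (suc (suc zero))    = refl
atLeast₃≡ (suc (suc (suc n))) = refl

module Split {s L Ts} (l : Layers s L Ts) (rich : ∀ {T} → T ∈ₗ Ts → 3 ≤ L # T) (x : ℕ)
  (ih : ∀ {L′ Ts′} → length L′ < length L → Layers s L′ Ts′ → (∀ {T} → T ∈ₗ Ts′ → 3 ≤ L′ # T) →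
        length Ts′ ≤ kk (length L′)) where
  L₁ Z Ts₁ Ts₀ : List FinSet
  L₁  = filter (has x) L
  Z   = filter (¬? ∘ has x) L
  Ts₁ = filter (has x) Ts
  Ts₀ = filter (¬? ∘ has x) Ts

  b ℓ y : ℕ
  b = length Z
  ℓ = length L₁
  y = length Ts₁

  lengths : length L ≡ b + ℓ
  lengths = length-split (has x) L ∙ +-comm ℓ b

  l₁ : Layers s L₁ Ts₁
  l₁ = layers-filterᵀ (layers-filter l (has x)) (has x)

  lZ₀ : Layers s Z Ts₀
  lZ₀ = layers-filterᵀ (layers-filter l (¬? ∘ has x)) (¬? ∘ has x)

  lZ₁ : Layers s Z Ts₁
  lZ₁ = layers-filterᵀ (layers-filter l (¬? ∘ has x)) (has x)

  x∉Z : ∀ {M} → M ∈ₗ Z → x ∉ₗ elements M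
  x∉Z M∈ = proj₂ (∈-filter⁻ (¬? ∘ has x) {xs = L} M∈)

  x∈L₁ : ∀ {M} → M ∈ₗ L₁ → x ∈ₗ elements M
  x∈L₁ M∈ = proj₂ (∈-filter⁻ (has x) {xs = L} M∈)

  x∈Ts₁ : ∀ {T} → T ∈ₗ Ts₁ → x ∈ₗ elements T
  x∈Ts₁ T∈ = proj₂ (∈-filter⁻ (has x) {xs = Ts} T∈)

  #-split : ∀ T → L # T ≡ L₁ # T + Z # T
  #-split T = ∑-split (has x) _ L

  rich₀ : ∀ {T} → T ∈ₗ Ts₀ → 3 ≤ Z # T
  rich₀ {T} T∈ = begin
    3                ≤⟨ rich (proj₁ (∈-filter⁻ (¬? ∘ has x) {xs = Ts} T∈)) ⟩
    L # T            ≡⟨ #-split T ⟩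
    L₁ # T + Z # T   ≡⟨ cong (_+ Z # T) (∑-none L₁ λ {M} M∈ → ⟦⟧-no (M ⊆? T) λ M⊆T →
                          proj₂ (∈-filter⁻ (¬? ∘ has x) {xs = Ts} T∈) (M⊆T (x∈L₁ M∈))) ⟩
    Z # T            ∎
    where open ≤-Reasoning

  -- A member of Z inside T can only be T without x.
  Z#≤1 : ∀ {T} → T ∈ₗ Ts₁ → Z # T ≤ 1
  Z#≤1 {T} T∈ = ∑-at-most-one (_⊆? T) (L-unique lZ₁) λ M∈ M′∈ M⊆ M′⊆ →
    ⋖-remove (cover lZ₁ M∈ T∈ M⊆) (cover lZ₁ M′∈ T∈ M′⊆) (x∈Ts₁ T∈) (x∉Z M∈) (x∉Z M′∈)

  rich₁ : ∀ {T} → T ∈ₗ Ts₁ → 3 ≤ L₁ # T + Z # T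
  rich₁ {T} T∈ = subst (3 ≤_) (#-split T) (rich (proj₁ (∈-filter⁻ (has x) {xs = Ts} T∈)))

  y≤s₂ : y ≤ s₂ L₁ Ts₁
  y≤s₂ = ≤-trans (≤-reflexive (length≡∑ Ts₁)) (∑-mono Ts₁ λ {T} T∈ → 1≤atLeast₂
    (+-cancelʳ-≤ 1 2 (L₁ # T) (≤-trans (rich₁ T∈) (+-monoʳ-≤ (L₁ # T) (Z#≤1 T∈)))))

  ∑Z≤b : ∑ (Z #_) Ts₁ ≤ b
  ∑Z≤b = begin
    ∑ (Z #_) Ts₁                                ≡⟨ ∑-swap (λ T M → ⟦ M ⊆? T ⟧) Ts₁ Z ⟩
    ∑ (λ M → ∑ (λ T → ⟦ M ⊆? T ⟧) Ts₁) Z        ≤⟨ ∑-mono Z (λ {M} M∈ → ∑-at-most-one (M ⊆?_) (Ts-unique lZ₁)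
      λ T∈ T′∈ M⊆T M⊆T′ → ⋖-join (cover lZ₁ M∈ T∈ M⊆T) (cover lZ₁ M∈ T′∈ M⊆T′) (x∈Ts₁ T∈) (x∈Ts₁ T′∈) (x∉Z M∈)) ⟩
    ∑ (λ _ → 1) Z                               ≡⟨ length≡∑ Z ⟨
    b                                           ∎
    where open ≤-Reasoning

  -- A T with no member of Z has at least three members of `L₁`. Any other T is charged to a member
  -- of Z inside it, and each member of Z is charged at most once.
  y≤b+s₃ : y ≤ b + s₃ L₁ Ts₁
  y≤b+s₃ = begin
    y                                           ≡⟨ length≡∑ Ts₁ ⟩
    ∑ (λ _ → 1) Ts₁                             ≤⟨ ∑-mono Ts₁ (λ {T} T∈ → pointwise (L₁ # T) (Z # T) (rich₁ T∈)) ⟩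
    ∑ (λ T → Z # T + atLeast₃ (L₁ # T)) Ts₁     ≡⟨ ∑-+ (Z #_) _ Ts₁ ⟩
    ∑ (Z #_) Ts₁ + s₃ L₁ Ts₁                    ≤⟨ +-monoˡ-≤ _ ∑Z≤b ⟩
    b + s₃ L₁ Ts₁                               ∎
    where
    open ≤-Reasoning
    pointwise : ∀ n z → 3 ≤ n + z → 1 ≤ z + atLeast₃ n
    pointwise n (suc z) _ = s≤s z≤n
    pointwise (suc (suc (suc n))) zero _ = s≤s z≤n
    pointwise zero zero ()
    pointwise (suc zero) zero (s≤s ())
    pointwise (suc (suc zero)) zero (s≤s (s≤s ()))

  y≤tri : y ≤ tri ℓ
  y≤tri = ≤-trans y≤s₂ (s₂≤tri l₁)

  -- `1 ≤ ℓ` makes Z shorter than L, so the induction hypothesis covers the T avoiding x, whose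
  -- subsets in L all lie in Z.
  total : 1 ≤ ℓ → length Ts ≤ kk b + y
  total 1≤ℓ = begin
    length Ts             ≡⟨ length-split (has x) Ts ⟩
    y + length Ts₀        ≤⟨ +-monoʳ-≤ y (ih (≤-trans (≤-reflexive (+-comm 1 b)) (≤-trans (+-monoʳ-≤ b 1≤ℓ) (≤-reflexive (sym lengths)))) lZ₀ rich₀) ⟩
    y + kk b              ≡⟨ +-comm y (kk b) ⟩
    kk b + y              ∎
    where open ≤-Reasoning

  s₃≤kk : 1 ≤ b → s₃ L₁ Ts₁ ≤ kk ℓ
  s₃≤kk 1≤b = begin
    s₃ L₁ Ts₁                                   ≡⟨ ∑-cong Ts₁ (λ {T} _ → atLeast₃≡ (L₁ # T)) ⟩
    ∑ (λ T → ⟦ 3 ≤? L₁ # T ⟧) Ts₁               ≡⟨ length-filter≡∑ (λ T → 3 ≤? L₁ # T) Ts₁ ⟨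
    length (filter (λ T → 3 ≤? L₁ # T) Ts₁)     ≤⟨ ih (≤-trans (+-monoˡ-≤ ℓ 1≤b) (≤-reflexive (sym lengths)))
      (layers-filterᵀ l₁ (λ T → 3 ≤? L₁ # T)) (λ T∈ → proj₂ (∈-filter⁻ (λ T → 3 ≤? L₁ # T) {xs = Ts₁} T∈)) ⟩
    kk ℓ                                        ∎
    where open ≤-Reasoning

  conclude : 4 ≤ b → 1 ≤ ℓ → length Ts ≤ kk (length L)
  conclude 4≤b 1≤ℓ = ≤-trans (total 1≤ℓ) (≤-trans
    (kk-split b ℓ y 4≤b y≤tri (λ c j → lines-bound l₁ {b} y≤s₂ y≤b+s₃ c j)
      (≤-trans y≤b+s₃ (+-monoʳ-≤ b (s₃≤kk (≤-trans (s≤s z≤n) 4≤b)))))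
    (≤-reflexive (cong kk (sym lengths))))

  -- Here b is below the range of `kk-split`, but the values match directly: `kk 3 + tri 2` and
  -- `kk 5` are both 2.
  conclude-3-2 : b ≡ 3 → ℓ ≡ 2 → length Ts ≤ kk (length L)
  conclude-3-2 b≡3 ℓ≡2 = begin
    length Ts       ≤⟨ total (≤-trans (s≤s z≤n) (≤-reflexive (sym ℓ≡2))) ⟩
    kk b + y        ≤⟨ +-monoʳ-≤ (kk b) y≤tri ⟩
    kk b + tri ℓ    ≡⟨ cong₂ (λ p q → kk p + tri q) b≡3 ℓ≡2 ⟩
    kk (3 + 2)      ≡⟨ cong kk (lengths ∙ cong₂ _+_ b≡3 ℓ≡2) ⟨
    kk (length L)   ∎
    where open ≤-Reasoning

through : List FinSet → FinSet → ℕ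
through Ts B = ∑ (λ T → ⟦ B ⊆? T ⟧) Ts

module _ {s L Ts} (l : Layers s L Ts) (rich : ∀ {T} → T ∈ₗ Ts → 3 ≤ L # T) where
  open ≤-Reasoning

  ∑≟≤1 : ∀ B → ∑ (λ M → ⟦ M ≟ˢ B ⟧) L ≤ 1
  ∑≟≤1 B = ∑-at-most-one (_≟ˢ B) (L-unique l) λ _ _ p q → p ∙ sym q

  sparse : ∀ {k} → (∀ {B} → B ∈ₗ L → through Ts B ≤ k) → 3 * length Ts ≤ k * length L
  sparse {k} h = begin
    3 * length Ts        ≡⟨ ∑-const 3 Ts ⟨
    ∑ (λ _ → 3) Ts       ≤⟨ ∑-mono Ts rich ⟩
    ∑ (L #_) Ts          ≡⟨ ∑-swap (λ T M → ⟦ M ⊆? T ⟧) Ts L ⟩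
    ∑ (through Ts) L     ≤⟨ ∑-mono L h ⟩
    ∑ (λ _ → k) L        ≡⟨ ∑-const k L ⟩
    k * length L         ∎

  -- The point x is taken in T₂ but not in T₁, hence outside B. All members of L inside T₁ avoid x,
  -- while of those inside T₂ only B does.
  module Two {B T₁ T₂} (B∈ : B ∈ₗ L) (T₁∈ : T₁ ∈ₗ Ts) (T₂∈ : T₂ ∈ₗ Ts) (B⊆₁ : B ⊆ T₁) (B⊆₂ : B ⊆ T₂) (T₁≢T₂ : T₁ ≢ T₂) where
    extra : ∃[ x ] x ∈ₗ elements T₂ × x ∉ₗ elements T₁
    extra = ⊈⇒∃ λ T₂⊆T₁ → T₁≢T₂ (sym (⊆⇒≡ T₂⊆T₁ (≤-reflexive (Ts-size l T₁∈ ∙ sym (Ts-size l T₂∈)))))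

    x : ℕ
    x = proj₁ extra

    x∈T₂ : x ∈ₗ elements T₂
    x∈T₂ = proj₁ (proj₂ extra)

    x∉T₁ : x ∉ₗ elements T₁
    x∉T₁ = proj₂ (proj₂ extra)

    x∉B : x ∉ₗ elements B
    x∉B x∈B = x∉T₁ (B⊆₁ x∈B)

    containing : 2 ≤ length (filter (has x) L)
    containing = +-cancelʳ-≤ 1 2 _ (begin
      3                                              ≤⟨ rich T₂∈ ⟩
      L # T₂                                         ≤⟨ ∑-mono L pointwise ⟩
      ∑ (λ M → ⟦ has x M ⟧ + ⟦ M ≟ˢ B ⟧) L           ≡⟨ ∑-+ _ _ L ⟩
      ∑ (⟦_⟧ ∘ has x) L + ∑ (λ M → ⟦ M ≟ˢ B ⟧) L     ≤⟨ +-mono-≤ (≤-reflexive (sym (length-filter≡∑ (has x) L))) (∑≟≤1 B) ⟩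
      length (filter (has x) L) + 1                  ∎)
      where
      pointwise : ∀ {M} → M ∈ₗ L → ⟦ M ⊆? T₂ ⟧ ≤ ⟦ has x M ⟧ + ⟦ M ≟ˢ B ⟧
      pointwise {M} M∈ with M ⊆? T₂ | has x M | M ≟ˢ B
      ... | no _  | _     | _     = z≤n
      ... | yes _ | yes _ | _     = s≤s z≤n
      ... | yes _ | no _  | yes _ = s≤s z≤n
      ... | yes M⊆ | no x∉M | no M≢B =
        contradiction (⋖-remove (cover l M∈ T₂∈ M⊆) (cover l B∈ T₂∈ B⊆₂) x∈T₂ x∉M x∉B) M≢B

    avoiding : 3 ≤ length (filter (¬? ∘ has x) L)
    avoiding = begin
      3                                ≤⟨ rich T₁∈ ⟩
      L # T₁                           ≤⟨ ∑-mono L (λ {M} _ → pointwise M) ⟩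
      ∑ (⟦_⟧ ∘ ¬? ∘ has x) L           ≡⟨ length-filter≡∑ (¬? ∘ has x) L ⟨
      length (filter (¬? ∘ has x) L)   ∎
      where
      pointwise : ∀ M → ⟦ M ⊆? T₁ ⟧ ≤ ⟦ ¬? (has x M) ⟧
      pointwise M with M ⊆? T₁ | has x M
      ... | no _  | _     = z≤n
      ... | yes _ | no _  = ≤-refl
      ... | yes M⊆ | yes x∈M = contradiction (M⊆ x∈M) x∉T₁

    -- T₃ avoids x too, since otherwise it would be B with x added, that is, T₂. The members of L
    -- inside T₁ and inside T₃ have only B in common, which leaves 3 + 3 - 1.
    avoiding₅ : ∀ {T₃} → T₃ ∈ₗ Ts → B ⊆ T₃ → T₁ ≢ T₃ → T₂ ≢ T₃ → 5 ≤ length (filter (¬? ∘ has x) L)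
    avoiding₅ {T₃} T₃∈ B⊆₃ T₁≢T₃ T₂≢T₃ = +-cancelʳ-≤ 1 5 _ (begin
      3 + 3                                              ≤⟨ +-mono-≤ (rich T₁∈) (rich T₃∈) ⟩
      L # T₁ + L # T₃                                    ≡⟨ ∑-+ _ _ L ⟨
      ∑ (λ M → ⟦ M ⊆? T₁ ⟧ + ⟦ M ⊆? T₃ ⟧) L              ≤⟨ ∑-mono L pointwise ⟩
      ∑ (λ M → ⟦ ¬? (has x M) ⟧ + ⟦ M ≟ˢ B ⟧) L          ≡⟨ ∑-+ _ _ L ⟩
      ∑ (⟦_⟧ ∘ ¬? ∘ has x) L + ∑ (λ M → ⟦ M ≟ˢ B ⟧) L    ≤⟨ +-mono-≤ (≤-reflexive (sym (length-filter≡∑ (¬? ∘ has x) L))) (∑≟≤1 B) ⟩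
      length (filter (¬? ∘ has x) L) + 1                 ∎)
      where
      x∉T₃ : x ∉ₗ elements T₃
      x∉T₃ x∈T₃ = T₂≢T₃ (⋖-join (cover l B∈ T₂∈ B⊆₂) (cover l B∈ T₃∈ B⊆₃) x∈T₂ x∈T₃ x∉B)
      pointwise : ∀ {M} → M ∈ₗ L → ⟦ M ⊆? T₁ ⟧ + ⟦ M ⊆? T₃ ⟧ ≤ ⟦ ¬? (has x M) ⟧ + ⟦ M ≟ˢ B ⟧
      pointwise {M} M∈ with M ⊆? T₁ | M ⊆? T₃ | has x M | M ≟ˢ B
      ... | no _   | no _   | _       | _     = z≤n
      ... | yes M⊆ | _      | yes x∈M | _     = contradiction (M⊆ x∈M) x∉T₁
      ... | _      | yes M⊆ | yes x∈M | _     = contradiction (M⊆ x∈M) x∉T₃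
      ... | yes _  | no _   | no _    | _     = s≤s z≤n
      ... | no _   | yes _  | no _    | _     = s≤s z≤n
      ... | yes _  | yes _  | no _    | yes _ = ≤-refl
      ... | yes M⊆₁ | yes M⊆₃ | no _  | no M≢B =
        contradiction (⋖-two (cover l M∈ T₁∈ M⊆₁) (cover l B∈ T₁∈ B⊆₁) (cover l M∈ T₃∈ M⊆₃) (cover l B∈ T₃∈ B⊆₃) M≢B) T₁≢T₃

  layers-↭ᵀ : ∀ {Ts′} → Ts ↭ Ts′ → Layers s L Ts′
  layers-↭ᵀ p .L-unique   = L-unique l
  layers-↭ᵀ p .L-size     = L-size l
  layers-↭ᵀ p .Ts-unique  = Unique-resp-↭ (↭⇒↭ₛ p) (Ts-unique l)
  layers-↭ᵀ p .Ts-size T∈ = Ts-size l (∈-resp-↭ (↭-sym p) T∈)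

-- The cases follow the largest number of T above one B. Three or more lead to `Split.conclude`. If
-- there are at most two, counting incidences settles |L| ≥ 6; if there is at most one, it also
-- settles |L| ≤ 5. What remains is |L| ≤ 5 with two T above some B.
partial-shadow-bound : ∀ n {s L Ts} → length L < n → Layers s L Ts → (∀ {T} → T ∈ₗ Ts → 3 ≤ L # T) →
  length Ts ≤ kk (length L)
partial-shadow-bound (suc n) {s} {L} {Ts} (s≤s len) l rich with any? (λ B → 3 ≤? through Ts B) L
... | yes ∃B with B , B∈ , 3≤ ← find ∃B with T₁ , T₂ , T₃ , _ , p , B⊆₁ , B⊆₂ , B⊆₃ ← pick₃ (B ⊆?_) Ts 3≤
             with (T₁≢T₂ ∷ T₁≢T₃ ∷ _) ∷ (T₂≢T₃ ∷ _) ∷ _ ← Ts-unique (layers-↭ᵀ l rich p) =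
  Split.conclude l rich x (λ lt → partial-shadow-bound n (≤-trans lt len))
    (≤-trans (n≤1+n 4) (avoiding₅ (∈-resp-↭ (↭-sym p) (there (there (here refl)))) B⊆₃ T₁≢T₃ T₂≢T₃)) (≤-trans (s≤s z≤n) containing)
  where open Two l rich {B} {T₁} {T₂} B∈ (∈-resp-↭ (↭-sym p) (here refl)) (∈-resp-↭ (↭-sym p) (there (here refl))) B⊆₁ B⊆₂ T₁≢T₂
... | no ∄B with 6 ≤? length L
...   | yes 6≤ = kk-sparse₂ _ _ 6≤ (sparse l rich λ B∈ → s≤s⁻¹ (≰⇒> λ 3≤ → ∄B (lose B∈ 3≤)))
...   | no 6≰ with any? (λ B → 2 ≤? through Ts B) L
...     | no ∄B₂ = kk-sparse₁ _ _ (s≤s⁻¹ (≰⇒> 6≰))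
  (≤-trans (sparse l rich λ B∈ → s≤s⁻¹ (≰⇒> λ 2≤ → ∄B₂ (lose B∈ 2≤))) (≤-reflexive (*-identityˡ _)))
...     | yes ∃B with B , B∈ , 2≤ ← find ∃B with T₁ , T₂ , _ , p , B⊆₁ , B⊆₂ ← pick₂ (B ⊆?_) Ts 2≤
                 with (T₁≢T₂ ∷ _) ∷ _ ← Ts-unique (layers-↭ᵀ l rich p) =
  -- |Z| ≥ 3 and |L₁| ≥ 2 with sum at most 5 force equality in both.
  conclude-3-2 (≤-antisym (+-cancelʳ-≤ 2 b 3 (≤-trans (+-monoʳ-≤ b containing) b+ℓ≤5)) avoiding)
    (≤-antisym (+-cancelˡ-≤ 3 ℓ 2 (≤-trans (+-monoˡ-≤ ℓ avoiding) b+ℓ≤5)) containing)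
  where
  open Two l rich {B} {T₁} {T₂} B∈ (∈-resp-↭ (↭-sym p) (here refl)) (∈-resp-↭ (↭-sym p) (there (here refl))) B⊆₁ B⊆₂ T₁≢T₂
    using (x; containing; avoiding)
  open Split l rich x (λ lt → partial-shadow-bound n (≤-trans lt len)) using (b; ℓ; lengths; conclude-3-2)
  b+ℓ≤5 : b + ℓ ≤ 5
  b+ℓ≤5 = ≤-trans (≤-reflexive (sym lengths)) (s≤s⁻¹ (≰⇒> 6≰))

-- Extremal families

-- A k-subset of n points as a sequence of choices, so that enumerating all of them follows Pascal's
-- rule.
data Sub : ℕ → ℕ → Set where
  nil  : Sub 0 0
  skip : ∀ {k n} → Sub k n → Sub k (suc n)
  take : ∀ {k n} → Sub k n → Sub (suc k) (suc n)

all : ∀ k n → List (Sub k n)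
all zero    zero    = nil ∷ []
all (suc k) zero    = []
all zero    (suc n) = map skip (all zero n)
all (suc k) (suc n) = map take (all k n) ++ map skip (all (suc k) n)

∈-all : ∀ {k n} (s : Sub k n) → s ∈ₗ all k n
∈-all nil              = here refl
∈-all {zero}  (skip s) = ∈-map⁺ skip (∈-all s)
∈-all {suc k} (skip s) = ∈-++⁺ʳ (map take (all k _)) (∈-map⁺ skip (∈-all s))
∈-all (take s)         = ∈-++⁺ˡ (∈-map⁺ take (∈-all s))

skip-injective : ∀ {k n} {s t : Sub k n} → skip s ≡ skip t → s ≡ t
skip-injective refl = refl

take-injective : ∀ {k n} {s t : Sub k n} → take s ≡ take t → s ≡ t
take-injective refl = refl

unique-take-skip : ∀ {k n} {xs : List (Sub k n)} {ys : List (Sub (suc k) n)} → Unique xs → Unique ys →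
  Unique (map take xs ++ map skip ys)
unique-take-skip u v = unique-++ (unique-map take-injective u) (unique-map skip-injective v) disjoint
  where
  disjoint : ∀ {z} → ¬ (z ∈ₗ map take _ × z ∈ₗ map skip _)
  disjoint (p , q) with _ , _ , refl ← ∈-map⁻ take p with _ , _ , () ← ∈-map⁻ skip q

unique-all : ∀ k n → Unique (all k n)
unique-all zero    zero    = [] ∷ []
unique-all (suc k) zero    = []
unique-all zero    (suc n) = unique-map skip-injective (unique-all zero n)
unique-all (suc k) (suc n) = unique-take-skip (unique-all k n) (unique-all (suc k) n)

length-take-skip : ∀ {k n} (xs : List (Sub k n)) (ys : List (Sub (suc k) n)) →
  length (map take xs ++ map skip ys) ≡ length xs + length ys
length-take-skip xs ys = length-++ (map take xs) ∙ cong₂ _+_ (length-map take xs) (length-map skip ys)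

length-all : ∀ k n → length (all k n) ≡ n C k
length-all zero    zero    = refl
length-all (suc k) zero    = refl
length-all zero    (suc n) = length-map skip (all zero n) ∙ length-all zero n
length-all (suc k) (suc n) = length-take-skip (all k n) (all (suc k) n) ∙
  (cong₂ _+_ (length-all k n) (length-all (suc k) n) ∙ nCk+nC[k+1]≡[n+1]C[k+1] n k)

faces : ∀ {k n} → Sub (suc k) n → List (Sub k n)
faces (skip t)         = map skip (faces t)
faces {zero}  (take t) = skip t ∷ []
faces {suc k} (take t) = skip t ∷ map take (faces t)

length-faces : ∀ {k n} (t : Sub (suc k) n) → length (faces t) ≡ suc k
length-faces (skip t)         = length-map skip (faces t) ∙ length-faces t
length-faces {zero}  (take t) = refl
length-faces {suc k} (take t) = cong suc (length-map take (faces t) ∙ length-faces t)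

unique-faces : ∀ {k n} (t : Sub (suc k) n) → Unique (faces t)
unique-faces (skip t)         = unique-map skip-injective (unique-faces t)
unique-faces {zero}  (take t) = [] ∷ []
unique-faces {suc k} (take t) = All-map⁺ (All.universal (λ _ ()) (faces t)) ∷ unique-map take-injective (unique-faces t)

toList : ∀ {k n} → ℕ → Sub k n → List ℕ
toList m nil      = []
toList m (skip s) = toList (suc m) s
toList m (take s) = m ∷ toList (suc m) s

toList-≥ : ∀ {k n} m (s : Sub k n) → All (m ≤_) (toList m s)
toList-≥ m nil      = []
toList-≥ m (skip s) = All.map (≤-trans (n≤1+n m)) (toList-≥ (suc m) s)
toList-≥ m (take s) = ≤-refl ∷ All.map (≤-trans (n≤1+n m)) (toList-≥ (suc m) s)

toList-increasing : ∀ {k n} m (s : Sub k n) → AllPairs _<_ (toList m s)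
toList-increasing m nil      = []
toList-increasing m (skip s) = toList-increasing (suc m) s
toList-increasing m (take s) = toList-≥ (suc m) s ∷ toList-increasing (suc m) s

length-toList : ∀ {k n} m (s : Sub k n) → length (toList m s) ≡ k
length-toList m nil      = refl
length-toList m (skip s) = length-toList (suc m) s
length-toList m (take s) = cong suc (length-toList (suc m) s)

toList-skip≢ : ∀ {k n m xs} (s : Sub k n) → toList (suc m) s ≢ m ∷ xs
toList-skip≢ {m = m} s eq with () ← <-irrefl refl (All.lookup (toList-≥ (suc m) s) (subst (m ∈ₗ_) (sym eq) (here refl)))

toList-injective : ∀ {k n} m (s t : Sub k n) → toList m s ≡ toList m t → s ≡ t
toList-injective m nil      nil      _  = refl
toList-injective m (skip s) (skip t) eq = cong skip (toList-injective (suc m) s t eq)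
toList-injective m (skip s) (take t) eq = contradiction eq (toList-skip≢ s)
toList-injective m (take s) (skip t) eq = contradiction (sym eq) (toList-skip≢ t)
toList-injective m (take s) (take t) eq = cong take (toList-injective (suc m) s t (∷-injectiveʳ eq))

faces⊆ : ∀ {k n} m (t : Sub (suc k) n) {f} → f ∈ₗ faces t → toList m f ⊆ₗ toList m t
faces⊆ m (skip t) f∈ with _ , g∈ , refl ← ∈-map⁻ skip f∈ = faces⊆ (suc m) t g∈
faces⊆ {zero}  m (take t) (here refl) x∈ = there x∈
faces⊆ {suc k} m (take t) (here refl) x∈ = there x∈
faces⊆ {suc k} m (take t) (there f∈)  x∈ with _ , g∈ , refl ← ∈-map⁻ take f∈ | x∈
... | here refl = here refl
... | there x∈′ = there (faces⊆ (suc m) t g∈ x∈′)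

-- A prefix of r common points raises the uniformity by r and preserves containments and the sizes
-- of families.
pad : ∀ {k n} r → Sub k n → Sub (r + k) (r + n)
pad zero    s = s
pad (suc r) s = take (pad r s)

pad-injective : ∀ {k n} r {s t : Sub k n} → pad r s ≡ pad r t → s ≡ t
pad-injective zero    eq = eq
pad-injective (suc r) eq = pad-injective r (take-injective eq)

pad⊆ : ∀ {k k′ n} r m {s : Sub k n} {t : Sub k′ n} → (∀ m → toList m s ⊆ₗ toList m t) →
  toList m (pad r s) ⊆ₗ toList m (pad r t)
pad⊆ zero    m h           = h m
pad⊆ (suc r) m h (here px) = here px
pad⊆ (suc r) m h (there x∈) = there (pad⊆ r (suc m) h x∈)

toFinSet : ∀ {k n} → ℕ → Sub k n → FinSet
toFinSet r s = mkFinSet (toList 0 (pad r s)) (toList-increasing 0 (pad r s))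

toFinSet-injective : ∀ {k n} r {s t : Sub k n} → toFinSet r s ≡ toFinSet r t → s ≡ t
toFinSet-injective r {s} {t} eq = pad-injective r (toList-injective 0 (pad r s) (pad r t) (cong elements eq))

family : ∀ {k n} → ℕ → List (Sub k n) → Family
family r ss S = S ∈ₗ map (toFinSet r) ss

card-family : ∀ {k n} r {ss : List (Sub k n)} → Unique ss → Exactly (length ss) (family r ss)
card-family r {ss} u = map (toFinSet r) ss , unique-map (toFinSet-injective r) u ,
  (λ _ → mk⇔ (λ p → p) (λ p → p)) , length-map (toFinSet r) ss

size-family : ∀ {k n} r {ss : List (Sub k n)} {S} → family r ss S → ∣ S ∣ ≡ r + k
size-family r S∈ with s , _ , refl ← ∈-map⁻ (toFinSet r) S∈ = length-toList 0 (pad r s)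

-- A set has exactly `suc k` faces, all contained in it, so closure under faces is enough.
admissible : ∀ {k n} r {As : List (Sub (suc k) n)} {Bs : List (Sub k n)} →
  (∀ {t f} → t ∈ₗ As → f ∈ₗ faces t → f ∈ₗ Bs) →
  Admissible (r + suc k) (suc k) (family r As) (family r Bs)
admissible r closed .Admissible.𝓐-size A A∈ = size-family r A∈
admissible {k} r closed .Admissible.𝓑-size B B∈ = cong suc (size-family r B∈) ∙ sym (+-suc r k)
admissible r closed .Admissible.contains A A∈ with t , t∈ , refl ← ∈-map⁻ (toFinSet r) A∈ =
  map (toFinSet r) (faces t) , unique-map (toFinSet-injective r) (unique-faces t) ,
  All-map⁺ (All.tabulate λ f∈ → ∈-map⁺ (toFinSet r) (closed t∈ f∈) , pad⊆ r 0 (λ m → faces⊆ m t f∈)) ,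
  length-map (toFinSet r) (faces t) ∙ length-faces t

skips : ∀ {k n} d → Sub k n → Sub k (d + n)
skips zero    s = s
skips (suc d) s = skip (skips d s)

skips-injective : ∀ {k n} d {s t : Sub k n} → skips d s ≡ skips d t → s ≡ t
skips-injective zero    eq = eq
skips-injective (suc d) eq = skips-injective d (skip-injective eq)

faces-skips : ∀ {k n} d (t : Sub (suc k) n) {f} → f ∈ₗ faces (skips d t) → f ∈ₗ map (skips d) (faces t)
faces-skips zero    t f∈ = subst (_ ∈ₗ_) (sym (map-id (faces t))) f∈
faces-skips (suc d) t f∈ with g , g∈ , refl ← ∈-map⁻ skip f∈ with h , h∈ , refl ← ∈-map⁻ (skips d) (faces-skips d t g∈) =
  ∈-map⁺ (skips (suc d)) h∈

-- All k-subsets of d + c points, and those k-subsets containing one further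
-- point whose other points lie among the last c.
initial : ∀ k d c → List (Sub (suc k) (suc (d + c)))
initial k d c = map take (map (skips d) (all k c)) ++ map skip (all (suc k) (d + c))

unique-initial : ∀ k d c → Unique (initial k d c)
unique-initial k d c = unique-take-skip (unique-map (skips-injective d) (unique-all k c)) (unique-all (suc k) (d + c))

length-initial : ∀ k d c → length (initial k d c) ≡ (d + c) C suc k + c C k
length-initial k d c = length-take-skip (map (skips d) (all k c)) (all (suc k) (d + c)) ∙
  (cong₂ _+_ (length-map (skips d) (all k c) ∙ length-all k c) (length-all (suc k) (d + c)) ∙ +-comm (c C k) _)

-- A face of a set through the further point either drops that point and falls into the full part,
-- or keeps it and still has its other points among the last c.
initial-closed : ∀ k d c {t f} → t ∈ₗ initial (suc k) d c → f ∈ₗ faces t → f ∈ₗ initial k d c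
initial-closed k d c t∈ f∈ with ∈-++⁻ (map take (map (skips d) (all (suc k) c))) t∈
... | inj₂ t∈′ with _ , _ , refl ← ∈-map⁻ skip t∈′ with g , _ , refl ← ∈-map⁻ skip f∈ =
  ∈-++⁺ʳ (map take (map (skips d) (all k c))) (∈-map⁺ skip (∈-all g))
... | inj₁ t∈′ with _ , u∈ , refl ← ∈-map⁻ take t∈′ with f∈
...   | here refl = ∈-++⁺ʳ (map take (map (skips d) (all k c))) (∈-map⁺ skip (∈-all _))
...   | there f∈′ with _ , g∈ , refl ← ∈-map⁻ take f∈′ with v , _ , refl ← ∈-map⁻ (skips d) u∈
        with h , _ , refl ← ∈-map⁻ (skips d) (faces-skips d v g∈) =
  ∈-++⁺ˡ (∈-map⁺ take (∈-map⁺ (skips d) (∈-all h)))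

-- Minima for k = 0 and k = 1

empty : Family
empty _ = ⊥

card-empty : Exactly 0 empty
card-empty = [] , [] , (λ _ → mk⇔ (λ ()) (λ ())) , refl

minimum-0 : ∀ r a → Attainable r 0 a → MinimumB r 0 a 0
minimum-0 r a (𝓐 , 𝓑 , adm , card) = (𝓐 , empty , adm′ , card , card-empty) , λ _ _ _ _ → [] , [] , [] , refl
  where
  adm′ : Admissible r 0 𝓐 empty
  adm′ .Admissible.𝓐-size      = Admissible.𝓐-size adm
  adm′ .Admissible.𝓑-size _ ()
  adm′ .Admissible.contains _ _ = [] , [] , [] , refl

minimum-1-empty : ∀ r → MinimumB r 1 [ 0 ] 0
minimum-1-empty r = (empty , empty , adm , card-empty , card-empty) , λ _ _ _ _ → [] , [] , [] , refl
  where
  adm : Admissible r 1 empty empty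
  adm .Admissible.𝓐-size _ ()
  adm .Admissible.𝓑-size _ ()
  adm .Admissible.contains _ ()

inhabited⇒atLeast-1 : ∀ {r 𝓐 𝓑} → Admissible r 1 𝓐 𝓑 → ∀ A → 𝓐 A → AtLeast 1 𝓑
inhabited⇒atLeast-1 adm A A∈ with Ss , u , all∈ , len ← Admissible.contains adm A A∈ = Ss , u , All.map proj₁ all∈ , len

-- The union over all n: an infinite family whose members consist of r common points and one more.
anySize : ℕ → Family
anySize r S = ∃ λ n → family r (all 1 n) S

toList-0 : ∀ {n} m (s : Sub 0 n) → toList m s ≡ []
toList-0 m nil      = refl
toList-0 m (skip s) = toList-0 (suc m) s

-- With nothing chosen beyond the common points the set does not depend on n, so one B serves all n
-- at once.
toList-pad-0 : ∀ {n n′} r m (s : Sub 0 n) (s′ : Sub 0 n′) → toList m (pad r s) ≡ toList m (pad r s′)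
toList-pad-0 zero    m s s′ = toList-0 m s ∙ sym (toList-0 m s′)
toList-pad-0 (suc r) m s s′ = cong (m ∷_) (toList-pad-0 r (suc m) s s′)

-- The r common points form the single member of 𝓑, and each member of 𝓐 adds one point to them.
minimum-1 : ∀ r a → [ 1 ] ≤⁺ a → MinimumB (r + 1) 1 a 1
minimum-1 r [ n ] [ 1≤n ] =
  (family r (all 1 n) , family r (all 0 n) , admissible r (λ _ _ → ∈-all _) ,
   subst (λ z → Exactly z (family r (all 1 n))) (length-all 1 n ∙ nC1≡n n) (card-family r (unique-all 1 n)) ,
   subst (λ z → Exactly z (family r (all 0 n))) (length-all 0 n) (card-family r (unique-all 0 n))) ,
  lower
  where
  lower : ∀ 𝓐 𝓑 → Admissible (r + 1) 1 𝓐 𝓑 → HasCard 𝓐 [ n ] → AtLeast 1 𝓑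
  lower 𝓐 𝓑 adm (A ∷ _ , _ , iff , _) = inhabited⇒atLeast-1 adm A (Equivalence.to (iff A) (here refl))
  lower 𝓐 𝓑 adm ([] , _ , _ , refl)   = contradiction 1≤n λ ()
minimum-1 r ⊤⁺ _ =
  (anySize r , family r (all 0 0) , adm ,
   (λ n → map (toFinSet r) (all 1 n) , unique-map (toFinSet-injective r) (unique-all 1 n) ,
     All.tabulate (λ S∈ → n , S∈) , length-map (toFinSet r) (all 1 n) ∙ (length-all 1 n ∙ nC1≡n n)) ,
   card-family r (unique-all 0 0)) ,
  lower
  where
  closed : ∀ {n} {t : Sub 1 n} {f} → t ∈ₗ all 1 n → f ∈ₗ faces t → f ∈ₗ all 0 n
  closed _ _ = ∈-all _
  module Adm n = Admissible (admissible {n = n} r closed)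
  same : ∀ {n S} → family r (all 0 n) S → family r (all 0 0) S
  same S∈ with s , _ , refl ← ∈-map⁻ (toFinSet r) S∈ = here (elements-injective (toList-pad-0 r 0 s nil))
  adm : Admissible (r + 1) 1 (anySize r) (family r (all 0 0))
  adm .Admissible.𝓐-size A (n , A∈) = Adm.𝓐-size n A A∈
  adm .Admissible.𝓑-size B B∈ = Adm.𝓑-size 0 B B∈
  adm .Admissible.contains A (n , A∈) with Ss , u , all∈ , len ← Adm.contains n A A∈ =
    Ss , u , All.map (λ (B∈ , B⊆A) → same B∈ , (λ {z} → B⊆A {z})) all∈ , len
  lower : ∀ 𝓐 𝓑 → Admissible (r + 1) 1 𝓐 𝓑 → HasCard 𝓐 ⊤⁺ → AtLeast 1 𝓑
  lower 𝓐 𝓑 adm′ card with card 1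
  ... | A ∷ [] , _ , A∈ ∷ [] , refl = inhabited⇒atLeast-1 adm′ A A∈

-- Maxima for k = 2 and k = 3

module Upper {r k 𝓐 𝓑 b} (adm : Admissible (suc r) k 𝓐 𝓑) (card : Exactly b 𝓑) where
  open Admissible adm

  Bs : List FinSet
  Bs = proj₁ card

  length-Bs : length Bs ≡ b
  length-Bs = proj₂ (proj₂ (proj₂ card))

  ∈Bs⇔ : ∀ S → S ∈ₗ Bs ⇔ 𝓑 S
  ∈Bs⇔ = proj₁ (proj₂ (proj₂ card))

  -- `AtMost` tests finite lists, so a possibly infinite or undecidable 𝓐 enters through a
  -- repetition-free list of its members.
  module _ {As} (As-unique : Unique As) (As⊆ : All 𝓐 As) where
    layers : Layers r Bs As
    layers .Layers.L-unique  = proj₁ (proj₂ card)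
    layers .Layers.L-size B∈ = suc-injective (𝓑-size _ (Equivalence.to (∈Bs⇔ _) B∈))
    layers .Layers.Ts-unique = As-unique
    layers .Layers.Ts-size A∈ = 𝓐-size _ (All.lookup As⊆ A∈)

    rich : ∀ {A} → A ∈ₗ As → k ≤ Bs # A
    rich {A} A∈ with Ss , u , all∈ , refl ← contains A (All.lookup As⊆ A∈) =
      ≤-trans (pigeonhole u λ S∈ → ∈-filter⁺ (_⊆? A) (Equivalence.from (∈Bs⇔ _) (proj₁ (All.lookup all∈ S∈)))
          (λ {z} → proj₂ (All.lookup all∈ S∈) {z}))
        (≤-reflexive (length-filter≡∑ (_⊆? A) Bs))

maximum-2 : ∀ r b → F (r + 2) 2 b (b C 2)
maximum-2 r b =
  (family r (all 2 b) , family r (all 1 b) , admissible r (λ _ _ → ∈-all _) ,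
   subst (λ z → Exactly z (family r (all 1 b))) (length-all 1 b ∙ nC1≡n b) (card-family r (unique-all 1 b)) ,
   subst (λ z → Exactly z (family r (all 2 b))) (length-all 2 b) (card-family r (unique-all 2 b))) ,
  upper (+-suc r 1)
  where
  open ≤-Reasoning
  -- The uniformity is a variable equated with a successor, the form `Upper` takes, because `r + 2`
  -- does not reduce to one.
  upper : ∀ {r′ s} → r′ ≡ suc s → ∀ 𝓐 𝓑 → Admissible r′ 2 𝓐 𝓑 → HasCard 𝓑 [ b ] → AtMost (b C 2) 𝓐
  upper refl 𝓐 𝓑 adm card As u As⊆ = begin
    length As           ≡⟨ length≡∑ As ⟩
    ∑ (λ _ → 1) As      ≤⟨ ∑-mono As (λ A∈ → 1≤atLeast₂ (rich u As⊆ A∈)) ⟩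
    s₂ Bs As            ≤⟨ s₂≤tri (layers u As⊆) ⟩
    tri (length Bs)     ≡⟨ cong tri length-Bs ⟩
    tri b               ≡⟨ tri≡C b ⟩
    b C 2               ∎
    where open Upper adm card

maximum-3 : ∀ r c₂ c₁ → c₁ < c₂ → F (r + 3) 3 (c₂ C 2 + c₁ C 1) (c₂ C 3 + c₁ C 2)
maximum-3 r c₂ c₁ c₁<c₂ with c₂ ∸ c₁ | m∸n+n≡m (<⇒≤ c₁<c₂)
-- c₂ is written as d + c₁, the number of points of the full part of `initial`.
... | d | refl =
  (family r (initial 2 d c₁) , family r (initial 1 d c₁) , admissible r (initial-closed 1 d c₁) ,
   subst (λ z → Exactly z (family r (initial 1 d c₁))) (length-initial 1 d c₁) (card-family r (unique-initial 1 d c₁)) ,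
   subst (λ z → Exactly z (family r (initial 2 d c₁))) (length-initial 2 d c₁) (card-family r (unique-initial 2 d c₁))) ,
  upper (+-suc r 2)
  where
  open ≤-Reasoning
  upper : ∀ {r′ s} → r′ ≡ suc s → ∀ 𝓐 𝓑 → Admissible r′ 3 𝓐 𝓑 →
    HasCard 𝓑 [ (d + c₁) C 2 + c₁ C 1 ] → AtMost ((d + c₁) C 3 + c₁ C 2) 𝓐
  upper refl 𝓐 𝓑 adm card As u As⊆ = begin
    length As                           ≤⟨ partial-shadow-bound _ ≤-refl (layers u As⊆) (rich u As⊆) ⟩
    kk (length Bs)                      ≡⟨ cong kk (length-Bs ∙ cong₂ _+_ (sym (tri≡C (d + c₁))) (nC1≡n c₁)) ⟩
    kk (tri (d + c₁) + c₁)              ≡⟨ kk-row (d + c₁) c₁ (<⇒≤ c₁<c₂) ⟩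
    tet (d + c₁) + tri c₁               ≡⟨ cong₂ _+_ (tet≡C (d + c₁)) (tri≡C c₁) ⟩
    (d + c₁) C 3 + c₁ C 2               ∎
    where open Upper adm card

theorem1 : ∀ (r k : ℕ) → k ≤ r →
    (k ≡ 0 → ∀ (a : ℕ ⁺) → Attainable r k a → MinimumB r k a 0) ×
    (k ≡ 1 → ∀ (a : ℕ ⁺) →
      ([ 1 ] ≤⁺ a → MinimumB r k a 1) ×
      (a ≡ [ 0 ] → MinimumB r k a 0)) ×
    (k ≡ 2 → ∀ (b : ℕ) → F r k b (b C 2)) ×
    (k ≡ 3 → ∀ (c₂ c₁ : ℕ) → c₁ < c₂ → 29 ≤ c₂ →
      F r k (c₂ C 2 + c₁ C 1) (c₂ C 3 + c₁ C 2))
-- With r written as d + k, prefixing d common points reduces the constructions to uniformity k.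
theorem1 r k k≤r with r ∸ k | m∸n+n≡m k≤r
... | d | refl =
  (λ { refl → minimum-0 (d + 0) }) ,
  (λ { refl a → minimum-1 d a , λ { refl → minimum-1-empty (d + 1) } }) ,
  (λ { refl → maximum-2 d }) ,
  (λ { refl c₂ c₁ c₁<c₂ _ → maximum-3 d c₂ c₁ c₁<c₂ })
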